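{- Let $\mathbf{V}$ be a variety of interior algebras. The restriction of the functor $\mathcal{O}$ to $\mathbf{V}$ is full (i.e. for all $A,B\in\mathbf{V}$, every Heyting algebra homomorphism $A^\circ\to B^\circ$ equals $\mathcal{O}(h)$ for some interior algebra homomorphism $h\colon A\to B$) if and only if $\mathbf{V}$ is a locally finite $^*$-variety. In this case, $\mathbf{V}$ and $\gamma(\mathbf{V})=\{A^\circ: A\in\mathbf{V}\}$ are categorically equivalent.
   Context: An interior algebra $\langle B,g\rangle$ is a Boolean algebra with an operator $g$ satisfying $g(1)=1$, $g(x\cdot y)=g(x)\cdot g(y)$, $g(x)\le x$, $g(g(x))=g(x)$; $a$ is open if $g(a)=a$. $\mathcal{O}(B)=B^\circ$ is the Heyting algebra of open elements with $a\Rightarrow b=g(-a+b)$, and for a homomorphism $h$, $\mathcal{O}(h)$ is the restriction of $h$ to open elements. $B$ is a $^*$-algebra if it is generated by its open elements; a variety $\mathbf{V}$ of interior algebras is a $^*$-variety if it is generated by the $^*$-algebras it contains. Two varieties are categorically equivalent if there is a full and faithful functor between them that is surjective on objects up to isomorphism. -}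

module Defs where

open import Algebra.Core using (Op₁)
open import Algebra.Lattice.Bundles using (BooleanAlgebra)
import Algebra.Lattice.Properties.BooleanAlgebra as BooleanAlgebraProperties
open import Data.Fin.Base using (Fin)
open import Data.Nat.Base using (ℕ)
open import Data.Product.Base using (Σ; ∃; _×_; _,_; proj₁; proj₂)
open import Function.Base using (_on_)
open import Function.Bundles using (Inverse)
open import Level using (Level; _⊔_; suc)
open import Relation.Binary.Bundles using (Poset)
open import Relation.Binary.Core using (Rel)
open import Relation.Binary.Lattice.Bundles using (HeytingAlgebra)
import Relation.Binary.Lattice.Bundles as OrderLatticeBundles
import Relation.Binary.PropositionalEquality as ≡
import Relation.Binary.Reasoning.Setoid as SetoidReasoning
open import Relation.Binary.Structures using (IsEquivalence)
open import Relation.Unary using (Pred)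

private
  variable
    c c₁ c₂ ℓ ℓ₁ ℓ₂ ℓ₃ o o′ m m′ e e′ p : Level

record Category (o m e : Level) : Set (suc (o ⊔ m ⊔ e)) where
  infix  4 _≈_ _⇒_
  infixr 9 _∘_
  field
    Obj : Set o
    _⇒_ : Rel Obj m
    _≈_ : ∀ {X Y} → Rel (X ⇒ Y) e
    id  : ∀ {X} → X ⇒ X
    _∘_ : ∀ {X Y Z} → Y ⇒ Z → X ⇒ Y → X ⇒ Z
    isEquivalence : ∀ {X Y} → IsEquivalence (_≈_ {X} {Y})
    ∘-resp-≈  : ∀ {X Y Z} {f f′ : Y ⇒ Z} {g g′ : X ⇒ Y} →
                f ≈ f′ → g ≈ g′ → f ∘ g ≈ f′ ∘ g′
    assoc     : ∀ {W X Y Z} {f : Y ⇒ Z} {g : X ⇒ Y} {h : W ⇒ X} →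
                (f ∘ g) ∘ h ≈ f ∘ (g ∘ h)
    identityˡ : ∀ {X Y} {f : X ⇒ Y} → id ∘ f ≈ f
    identityʳ : ∀ {X Y} {f : X ⇒ Y} → f ∘ id ≈ f

record Iso (C : Category o m e) (X Y : Category.Obj C) : Set (m ⊔ e) where
  open Category C
  field
    to   : X ⇒ Y
    from : Y ⇒ X
    to∘from : to ∘ from ≈ id
    from∘to : from ∘ to ≈ id

record Functor (C : Category o m e) (D : Category o′ m′ e′)
               : Set (o ⊔ m ⊔ e ⊔ o′ ⊔ m′ ⊔ e′) where
  private
    module C = Category C
    module D = Category D
  field
    F₀ : C.Obj → D.Obj
    F₁ : ∀ {X Y} → X C.⇒ Y → F₀ X D.⇒ F₀ Y
    F-resp-≈     : ∀ {X Y} {f g : X C.⇒ Y} → f C.≈ g → F₁ f D.≈ F₁ g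
    identity     : ∀ {X} → F₁ (C.id {X}) D.≈ D.id
    homomorphism : ∀ {X Y Z} {f : Y C.⇒ Z} {g : X C.⇒ Y} →
                   F₁ (f C.∘ g) D.≈ F₁ f D.∘ F₁ g

module _ {C : Category o m e} {D : Category o′ m′ e′} (F : Functor C D) where
  private
    module C = Category C
    module D = Category D
  open Functor F

  Full : Set (o ⊔ m ⊔ m′ ⊔ e′)
  Full = ∀ {X Y} (k : F₀ X D.⇒ F₀ Y) → ∃ λ (h : X C.⇒ Y) → F₁ h D.≈ k

  Faithful : Set (o ⊔ m ⊔ e ⊔ e′)
  Faithful = ∀ {X Y} (f g : X C.⇒ Y) → F₁ f D.≈ F₁ g → f C.≈ g

  EssentiallySurjective : Set (o ⊔ o′ ⊔ m′ ⊔ e′)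
  EssentiallySurjective = ∀ Y → ∃ λ X → Iso D (F₀ X) Y

CategoricallyEquivalent : Category o m e → Category o′ m′ e′ →
                          Set (o ⊔ m ⊔ e ⊔ o′ ⊔ m′ ⊔ e′)
CategoricallyEquivalent C D =
  ∃ λ (F : Functor C D) → Full F × Faithful F × EssentiallySurjective F

fullSubcategory : (C : Category o m e) → Pred (Category.Obj C) p →
                  Category (o ⊔ p) m e
fullSubcategory C P = record
  { Obj = Σ Obj P
  ; _⇒_ = _⇒_ on proj₁
  ; _≈_ = _≈_
  ; id  = id
  ; _∘_ = _∘_
  ; isEquivalence = isEquivalence
  ; ∘-resp-≈  = ∘-resp-≈
  ; assoc     = assoc
  ; identityˡ = identityˡ
  ; identityʳ = identityʳ
  }
  where open Category C

restrict : {C : Category o m e} {D : Category o′ m′ e′} →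
           Functor C D → (P : Pred (Category.Obj C) p) →
           Functor (fullSubcategory C P) D
restrict F P = record
  { F₀ = λ X → F₀ (proj₁ X)
  ; F₁ = F₁
  ; F-resp-≈     = F-resp-≈
  ; identity     = identity
  ; homomorphism = homomorphism
  }
  where open Functor F

record InteriorAlgebra (c ℓ : Level) : Set (suc (c ⊔ ℓ)) where
  field
    booleanAlgebra : BooleanAlgebra c ℓ

  open BooleanAlgebra booleanAlgebra public
  -- The lattice order: x ≤ y is x ≈ x ∧ y.
  open Poset (BooleanAlgebraProperties.poset booleanAlgebra) public
    using (_≤_)

  field
    g      : Op₁ Carrier
    g-cong : ∀ {x y} → x ≈ y → g x ≈ g y
    g-⊤    : g ⊤ ≈ ⊤
    g-∧    : ∀ x y → g (x ∧ y) ≈ g x ∧ g y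
    g-≤    : ∀ x → g x ≤ x
    g-idem : ∀ x → g (g x) ≈ g x

  IsOpen : Pred Carrier ℓ
  IsOpen x = g x ≈ x

record InteriorHom (A : InteriorAlgebra c₁ ℓ₁) (B : InteriorAlgebra c₂ ℓ₂)
                   : Set (c₁ ⊔ ℓ₁ ⊔ c₂ ⊔ ℓ₂) where
  private
    module A = InteriorAlgebra A
    module B = InteriorAlgebra B
  field
    ⟦_⟧    : A.Carrier → B.Carrier
    cong   : ∀ {x y} → x A.≈ y → ⟦ x ⟧ B.≈ ⟦ y ⟧
    ∨-homo : ∀ x y → ⟦ x A.∨ y ⟧ B.≈ ⟦ x ⟧ B.∨ ⟦ y ⟧
    ∧-homo : ∀ x y → ⟦ x A.∧ y ⟧ B.≈ ⟦ x ⟧ B.∧ ⟦ y ⟧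
    ¬-homo : ∀ x → ⟦ A.¬ x ⟧ B.≈ B.¬ ⟦ x ⟧
    ⊤-homo : ⟦ A.⊤ ⟧ B.≈ B.⊤
    ⊥-homo : ⟦ A.⊥ ⟧ B.≈ B.⊥
    g-homo : ∀ x → ⟦ A.g x ⟧ B.≈ B.g ⟦ x ⟧

IA : ∀ c ℓ → Category (suc (c ⊔ ℓ)) (c ⊔ ℓ) (c ⊔ ℓ)
IA c ℓ = record
  { Obj = InteriorAlgebra c ℓ
  ; _⇒_ = InteriorHom
  ; _≈_ = λ {_} {B} h k → ∀ x → InteriorAlgebra._≈_ B (⟦ h ⟧ x) (⟦ k ⟧ x)
  ; id  = λ {A} → let open InteriorAlgebra A in record
    { ⟦_⟧    = λ x → x
    ; cong   = λ eq → eq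
    ; ∨-homo = λ _ _ → refl
    ; ∧-homo = λ _ _ → refl
    ; ¬-homo = λ _ → refl
    ; ⊤-homo = refl
    ; ⊥-homo = refl
    ; g-homo = λ _ → refl
    }
  ; _∘_ = λ {_} {_} {C} h k →
      let open InteriorAlgebra C
          module H = InteriorHom h
          module K = InteriorHom k
      in record
    { ⟦_⟧    = λ x → ⟦ h ⟧ (⟦ k ⟧ x)
    ; cong   = λ eq → H.cong (K.cong eq)
    ; ∨-homo = λ x y → trans (H.cong (K.∨-homo x y)) (H.∨-homo _ _)
    ; ∧-homo = λ x y → trans (H.cong (K.∧-homo x y)) (H.∧-homo _ _)
    ; ¬-homo = λ x → trans (H.cong (K.¬-homo x)) (H.¬-homo _)
    ; ⊤-homo = trans (H.cong K.⊤-homo) H.⊤-homo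
    ; ⊥-homo = trans (H.cong K.⊥-homo) H.⊥-homo
    ; g-homo = λ x → trans (H.cong (K.g-homo x)) (H.g-homo _)
    }
  ; isEquivalence = λ {_} {B} → let open InteriorAlgebra B in record
    { refl  = λ _ → refl
    ; sym   = λ eq x → sym (eq x)
    ; trans = λ eq eq′ x → trans (eq x) (eq′ x)
    }
  ; ∘-resp-≈  = λ {_} {_} {Z} {f} {f′} {k} {k′} p q x →
      InteriorAlgebra.trans Z (InteriorHom.cong f (q x)) (p (⟦ k′ ⟧ x))
  ; assoc     = λ {_} {_} {_} {Z} _ → InteriorAlgebra.refl Z
  ; identityˡ = λ {_} {Y} _ → InteriorAlgebra.refl Y
  ; identityʳ = λ {_} {Y} _ → InteriorAlgebra.refl Y
  }
  where open InteriorHom using (⟦_⟧)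

record HeytingHom (H : HeytingAlgebra c₁ ℓ₁ ℓ₂) (K : HeytingAlgebra c₂ ℓ ℓ₃)
                  : Set (c₁ ⊔ ℓ₁ ⊔ c₂ ⊔ ℓ) where
  private
    module H = HeytingAlgebra H
    module K = HeytingAlgebra K
  field
    ⟦_⟧    : H.Carrier → K.Carrier
    cong   : ∀ {x y} → x H.≈ y → ⟦ x ⟧ K.≈ ⟦ y ⟧
    ∨-homo : ∀ x y → ⟦ x H.∨ y ⟧ K.≈ ⟦ x ⟧ K.∨ ⟦ y ⟧
    ∧-homo : ∀ x y → ⟦ x H.∧ y ⟧ K.≈ ⟦ x ⟧ K.∧ ⟦ y ⟧
    ⇨-homo : ∀ x y → ⟦ x H.⇨ y ⟧ K.≈ (⟦ x ⟧ K.⇨ ⟦ y ⟧)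
    ⊤-homo : ⟦ H.⊤ ⟧ K.≈ K.⊤
    ⊥-homo : ⟦ H.⊥ ⟧ K.≈ K.⊥

HA : ∀ c ℓ₁ ℓ₂ → Category (suc (c ⊔ ℓ₁ ⊔ ℓ₂)) (c ⊔ ℓ₁) (c ⊔ ℓ₁)
HA c ℓ₁ ℓ₂ = record
  { Obj = HeytingAlgebra c ℓ₁ ℓ₂
  ; _⇒_ = HeytingHom
  ; _≈_ = λ {_} {K} h k → ∀ x → HeytingAlgebra._≈_ K (⟦ h ⟧ x) (⟦ k ⟧ x)
  ; id  = λ {H} → let open Eq H in record
    { ⟦_⟧    = λ x → x
    ; cong   = λ eq → eq
    ; ∨-homo = λ _ _ → refl
    ; ∧-homo = λ _ _ → refl
    ; ⇨-homo = λ _ _ → refl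
    ; ⊤-homo = refl
    ; ⊥-homo = refl
    }
  ; _∘_ = λ {_} {_} {L} h k →
      let open Eq L
          module H = HeytingHom h
          module K = HeytingHom k
      in record
    { ⟦_⟧    = λ x → ⟦ h ⟧ (⟦ k ⟧ x)
    ; cong   = λ eq → H.cong (K.cong eq)
    ; ∨-homo = λ x y → trans (H.cong (K.∨-homo x y)) (H.∨-homo _ _)
    ; ∧-homo = λ x y → trans (H.cong (K.∧-homo x y)) (H.∧-homo _ _)
    ; ⇨-homo = λ x y → trans (H.cong (K.⇨-homo x y)) (H.⇨-homo _ _)
    ; ⊤-homo = trans (H.cong K.⊤-homo) H.⊤-homo
    ; ⊥-homo = trans (H.cong K.⊥-homo) H.⊥-homo
    }
  ; isEquivalence = λ {_} {K} → let open Eq K in record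
    { refl  = λ _ → refl
    ; sym   = λ eq x → sym (eq x)
    ; trans = λ eq eq′ x → trans (eq x) (eq′ x)
    }
  ; ∘-resp-≈  = λ {_} {_} {Z} {f} {f′} {k} {k′} p q x →
      Eq.trans Z (HeytingHom.cong f (q x)) (p (⟦ k′ ⟧ x))
  ; assoc     = λ {_} {_} {_} {Z} _ → Eq.refl Z
  ; identityˡ = λ {_} {Y} _ → Eq.refl Y
  ; identityʳ = λ {_} {Y} _ → Eq.refl Y
  }
  where
  open HeytingHom using (⟦_⟧)
  module Eq (H : HeytingAlgebra c ℓ₁ ℓ₂) =
    IsEquivalence (HeytingAlgebra.isEquivalence H)

module _ (A : InteriorAlgebra c ℓ) where
  open InteriorAlgebra A
  open BooleanAlgebraProperties booleanAlgebra
    using (∧-identityʳ; ∧-zeroˡ; ∨-identityˡ; ∨-∧-orderTheoreticLattice)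
  open OrderLatticeBundles.Lattice ∨-∧-orderTheoreticLattice
    using (antisym; x≤x∨y; y≤x∨y; ∨-least; x∧y≤x; x∧y≤y; ∧-greatest)
    renaming (trans to ≤-trans; reflexive to ≤-reflexive)

  private
    g-mono : ∀ {x y} → x ≤ y → g x ≤ g y
    g-mono {x} {y} x≤y = trans (g-cong x≤y) (g-∧ x y)

    g-open : ∀ x → IsOpen (g x)
    g-open = g-idem

    ∧-open : ∀ {x y} → IsOpen x → IsOpen y → IsOpen (x ∧ y)
    ∧-open {x} {y} gx gy = trans (g-∧ x y) (∧-cong gx gy)

    ∨-open : ∀ {x y} → IsOpen x → IsOpen y → IsOpen (x ∨ y)
    ∨-open {x} {y} gx gy = antisym (g-≤ (x ∨ y))
      (∨-least (≤-trans (≤-reflexive (sym gx)) (g-mono (x≤x∨y x y)))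
               (≤-trans (≤-reflexive (sym gy)) (g-mono (y≤x∨y x y))))

    ⊥-open : IsOpen ⊥
    ⊥-open = antisym (g-≤ ⊥) (sym (∧-zeroˡ (g ⊥)))

    residuate : ∀ {w x y} → w ∧ x ≤ y → w ≤ ¬ x ∨ y
    residuate {w} {x} {y} w∧x≤y = ≤-trans (≤-reflexive w≈) (∨-least
        (≤-trans (x∧y≤y w (¬ x)) (x≤x∨y (¬ x) y))
        (≤-trans w∧x≤y (y≤x∨y (¬ x) y)))
      where
      open SetoidReasoning setoid
      w≈ : w ≈ (w ∧ ¬ x) ∨ (w ∧ x)
      w≈ = begin
        w                     ≈⟨ ∧-identityʳ w ⟨
        w ∧ ⊤                 ≈⟨ ∧-cong refl (∨-complementˡ x) ⟨
        w ∧ (¬ x ∨ x)         ≈⟨ ∧-distribˡ-∨ w (¬ x) x ⟩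
        (w ∧ ¬ x) ∨ (w ∧ x)   ∎

    unresiduate : ∀ {w x y} → w ≤ ¬ x ∨ y → w ∧ x ≤ y
    unresiduate {w} {x} {y} w≤ = ≤-trans
        (∧-greatest (x∧y≤y w x) (≤-trans (x∧y≤x w x) w≤))
        (≤-trans (≤-reflexive mp) (x∧y≤y x y))
      where
      open SetoidReasoning setoid
      mp : x ∧ (¬ x ∨ y) ≈ x ∧ y
      mp = begin
        x ∧ (¬ x ∨ y)         ≈⟨ ∧-distribˡ-∨ x (¬ x) y ⟩
        (x ∧ ¬ x) ∨ (x ∧ y)   ≈⟨ ∨-cong (∧-complementʳ x) refl ⟩
        ⊥ ∨ (x ∧ y)           ≈⟨ ∨-identityˡ (x ∧ y) ⟩
        x ∧ y                 ∎

  infix 10 _°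
  _° : HeytingAlgebra (c ⊔ ℓ) ℓ ℓ
  _° = record
    { Carrier = Σ Carrier IsOpen
    ; _≈_ = _≈_ on proj₁
    ; _≤_ = _≤_ on proj₁
    ; _∨_ = λ (a , ga) (b , gb) → a ∨ b , ∨-open ga gb
    ; _∧_ = λ (a , ga) (b , gb) → a ∧ b , ∧-open ga gb
    ; _⇨_ = λ (a , _) (b , _) → g (¬ a ∨ b) , g-open (¬ a ∨ b)
    ; ⊤ = ⊤ , g-⊤
    ; ⊥ = ⊥ , ⊥-open
    ; isHeytingAlgebra = record
      { isBoundedLattice = record
        { isLattice = record
          { isPartialOrder = record
            { isPreorder = record
              { isEquivalence = record { refl = refl ; sym = sym ; trans = trans }
              ; reflexive = ≤-reflexive
              ; trans = ≤-trans
              }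
            ; antisym = antisym
            }
          ; supremum = λ (a , _) (b , _) →
              x≤x∨y a b , y≤x∨y a b , λ _ → ∨-least
          ; infimum = λ (a , _) (b , _) →
              x∧y≤x a b , x∧y≤y a b , λ _ → ∧-greatest
          }
        ; maximum = λ (a , _) → sym (∧-identityʳ a)
        ; minimum = λ (a , _) → sym (∧-zeroˡ a)
        }
      ; exponential = λ (w , gw) (a , _) (b , _) →
          (λ w∧a≤b → ≤-trans (≤-reflexive (sym gw)) (g-mono (residuate w∧a≤b)))
        , (λ w≤ → unresiduate (≤-trans w≤ (g-≤ (¬ a ∨ b))))
      }
    }

𝒪 : Functor (IA c ℓ) (HA (c ⊔ ℓ) ℓ ℓ)
𝒪 = record
  { F₀ = _°
  ; F₁ = λ {A} {B} h →
      let open InteriorAlgebra B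
          module A = InteriorAlgebra A
          open InteriorHom h
      in record
    { ⟦_⟧    = λ (a , ga) → ⟦ a ⟧ , trans (sym (g-homo a)) (cong ga)
    ; cong   = cong
    ; ∨-homo = λ (a , _) (b , _) → ∨-homo a b
    ; ∧-homo = λ (a , _) (b , _) → ∧-homo a b
    ; ⇨-homo = λ (a , _) (b , _) → trans (g-homo (A.¬ a A.∨ b))
        (g-cong (trans (∨-homo (A.¬ a) b) (∨-cong (¬-homo a) refl)))
    ; ⊤-homo = ⊤-homo
    ; ⊥-homo = ⊥-homo
    }
  ; F-resp-≈     = λ eq (a , _) → eq a
  ; identity     = λ {A} _ → InteriorAlgebra.refl A
  ; homomorphism = λ {_} {_} {C} _ → InteriorAlgebra.refl C
  }

data Term : Set where
  var     : ℕ → Term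
  _∨_ _∧_ : Term → Term → Term
  ¬_ g    : Term → Term
  ⊤ ⊥     : Term

module _ (A : InteriorAlgebra c ℓ) where
  private
    module A = InteriorAlgebra A

  eval : (ℕ → A.Carrier) → Term → A.Carrier
  eval ρ (var i) = ρ i
  eval ρ (s ∨ t) = eval ρ s A.∨ eval ρ t
  eval ρ (s ∧ t) = eval ρ s A.∧ eval ρ t
  eval ρ (¬ t)   = A.¬ eval ρ t
  eval ρ (g t)   = A.g (eval ρ t)
  eval ρ ⊤       = A.⊤
  eval ρ ⊥       = A.⊥

  Satisfies : Term → Term → Set (c ⊔ ℓ)
  Satisfies s t = ∀ ρ → eval ρ s A.≈ eval ρ t

-- An equational class, given by a set of identities; Models V is its class of
-- members, and varieties are only ever compared through it.
record Variety (ℓ : Level) : Set (suc ℓ) where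
  field
    Identity : Rel Term ℓ

Models : Variety ℓ → Pred (InteriorAlgebra ℓ ℓ) ℓ
Models V A = ∀ {s t} → Variety.Identity V s t → Satisfies A s t

GeneratedBy : Variety ℓ → Pred (InteriorAlgebra ℓ ℓ) p → Set (suc ℓ ⊔ p)
GeneratedBy {ℓ} V K =
  (∀ A → K A → Models V A) ×
  (∀ (W : Variety ℓ) → (∀ A → K A → Models W A) → ∀ A → Models V A → Models W A)

module _ (A : InteriorAlgebra c ℓ) where
  private
    module A = InteriorAlgebra A

  data Sg (S : Pred A.Carrier p) : Pred A.Carrier (c ⊔ ℓ ⊔ p) where
    base   : ∀ {x} → S x → Sg S x
    resp   : ∀ {x y} → x A.≈ y → Sg S x → Sg S y
    ∨-clos : ∀ {x y} → Sg S x → Sg S y → Sg S (x A.∨ y)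
    ∧-clos : ∀ {x y} → Sg S x → Sg S y → Sg S (x A.∧ y)
    ¬-clos : ∀ {x} → Sg S x → Sg S (A.¬ x)
    g-clos : ∀ {x} → Sg S x → Sg S (A.g x)
    ⊤-clos : Sg S A.⊤
    ⊥-clos : Sg S A.⊥

  Generates : Pred A.Carrier p → Set (c ⊔ ℓ ⊔ p)
  Generates S = ∀ x → Sg S x

  IsStarAlgebra : Set (c ⊔ ℓ)
  IsStarAlgebra = Generates A.IsOpen

  IsFinitelyGenerated : Set (c ⊔ ℓ)
  IsFinitelyGenerated =
    ∃ λ n → ∃ λ (a : Fin n → A.Carrier) → Generates (λ x → ∃ λ i → a i A.≈ x)

  -- Cardinality is that of the quotient of Carrier by _≈_.
  IsFinite : Set (c ⊔ ℓ)
  IsFinite = ∃ λ n → Inverse (≡.setoid (Fin n)) A.setoid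

IsStarVariety : Variety ℓ → Set (suc ℓ)
IsStarVariety V = GeneratedBy V (λ A → Models V A × IsStarAlgebra A)

IsLocallyFinite : Variety ℓ → Set (suc ℓ)
IsLocallyFinite V = ∀ A → Models V A → IsFinitelyGenerated A → IsFinite A

𝐕 : Variety ℓ → Category (suc ℓ) ℓ ℓ
𝐕 {ℓ} V = fullSubcategory (IA ℓ ℓ) (Models V)

𝒪∣ : (V : Variety ℓ) → Functor (𝐕 V) (HA ℓ ℓ ℓ)
𝒪∣ V = restrict 𝒪 (Models V)

-- The class { A ° : A ∈ V }, closed under isomorphism.
γ : Variety ℓ → Pred (HeytingAlgebra ℓ ℓ ℓ) (suc ℓ)
γ {ℓ} V H = ∃ λ A → Models V A × Iso (HA ℓ ℓ ℓ) (A °) H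

γ-category : Variety ℓ → Category (suc ℓ) ℓ ℓ
γ-category {ℓ} V = fullSubcategory (HA ℓ ℓ ℓ) (γ V)

{-# OPTIONS --safe #-}
module Submission where

-- Both conditions are equivalent to: every algebra of V is a *-algebra.  Elements of
-- a *-algebra are finite meets of clauses ¬ a ∨ b with a and b open, and such normal
-- forms show that Heyting homomorphisms A ° → B ° extend uniquely to A.
--
-- If 𝒪 is full on V, the identity of A ° extends to a homomorphism from A onto the
-- subalgebra generated by the open elements; it is injective, so A is a *-algebra.
--
-- If V is a *-variety, it satisfies Grzegorczyk's inequality, because *-algebras do
-- (induction on the number of clauses).  In a finite algebra this inequality makes
-- every x open-generated: enlarge an open o to o ∨ g (o ∨ x) ∨ g (o ∨ ¬ x) until it
-- stabilises, which can only happen at ⊤.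
--
-- If all algebras of V are *-algebras and A ∈ V is finitely generated, build A from
-- the top in layers o₀ ≤ o₁ ≤ …, each oₙ a finite join of atoms, where an atom of
-- the next layer is determined by the generators above it and the atoms of oₙ that
-- it sees.
-- The alternating elements ⋁ (o₂ᵢ₊₂ ∧ ¬ o₂ᵢ₊₁) over i < N form an element of A^ℕ; as
-- A^ℕ is a *-algebra they have normal forms of bounded length, which forces some oₙ
-- to be ⊤.

open import Defs hiding (Term; var; _∨_; _∧_; ¬_; g; ⊤; ⊥)
open import Defs using (module Term)
open import Algebra.Lattice.Bundles using (BooleanAlgebra)
import Algebra.Lattice.Properties.BooleanAlgebra as BooleanAlgebraProperties
open import Axiom.ExcludedMiddle using (ExcludedMiddle)
open import Data.Bool.Base as Bool using (Bool; true; false; T; not)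
open import Data.Bool.Properties using (T-∧)
open import Data.Fin.Base as Fin using (Fin; toℕ)
open import Data.Fin.Properties using (pigeonhole)
open import Data.List.Base
  using (List; []; _∷_; _++_; [_]; map; foldr; length; lookup; deduplicate; tabulate)
open import Data.List.Membership.Propositional.Properties using (∈-lookup)
open import Data.List.Relation.Unary.All as All using (All; []; _∷_)
import Data.List.Relation.Unary.All.Properties as All
open import Data.List.Relation.Unary.AllPairs using (_∷_)
open import Data.List.Relation.Unary.Any as Any using (Any; here; index)
import Data.List.Relation.Unary.Any.Properties as Any
open import Data.List.Relation.Unary.Enumerates.Setoid using (IsEnumeration)
import Data.List.Relation.Unary.Enumerates.Setoid.Properties as Enumerates
open import Data.List.Relation.Unary.Unique.Setoid using (Unique)
import Data.List.Relation.Unary.Unique.DecSetoid.Properties as UniqueDec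
open import Data.Nat.Base as ℕ using (ℕ; zero; suc; _+_)
import Data.Nat.Properties as ℕ
open import Data.Product.Base using (∃; Σ; _×_; _,_; proj₁; proj₂)
open import Data.Sum.Base using (_⊎_; inj₁; inj₂)
open import Data.Vec.Base as Vec using (Vec; []; _∷_)
open import Data.Vec.N-ary using (N-ary; _$ⁿ_)
open import Data.Vec.Relation.Binary.Pointwise.Inductive as Pointwise
  using (Pointwise; []; _∷_)
open import Function.Base using (_on_; id)
open import Function.Bundles using (Equivalence; Inverse; _⇔_; mk⇔)
open import Level using (Level; Lift; lift) renaming (_⊔_ to _⊔ˡ_)
open import Relation.Binary.Bundles using (DecSetoid; Poset; Setoid)
open import Relation.Binary.Definitions using (Decidable)
open import Relation.Binary.Lattice.Bundles using (HeytingAlgebra)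
import Relation.Binary.Lattice.Bundles as OrderLatticeBundles
open import Relation.Binary.PropositionalEquality.Core as ≡ using (_≡_)
open import Relation.Nullary.Decidable.Core using (yes; no)
open import Relation.Nullary.Negation.Core using (contradiction)
open import Relation.Unary using (Pred)

private
  variable
    c ℓ c₁ c₂ ℓ₁ ℓ₂ i p q : Level
    n : ℕ

-- A truth-table decision procedure for quasi-identities of Boolean algebras

infixr 7 _⊓_
infixr 6 _⊔_
infix 8 ∼_
infix 4 _≐_ _⊑_
infixr 3 _⇛_
infix 3 ⊢_

data Expr (n : ℕ) : Set where
  var     : Fin n → Expr n
  _⊓_ _⊔_ : Expr n → Expr n → Expr n
  ∼_      : Expr n → Expr n
  𝟙 𝟘     : Expr n

data Equation (n : ℕ) : Set where
  _≐_ : Expr n → Expr n → Equation n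

_⊑_ : Expr n → Expr n → Equation n
s ⊑ t = s ≐ s ⊓ t

data Sequent (n : ℕ) : Set where
  ⊢_  : Equation n → Sequent n
  _⇛_ : Equation n → Sequent n → Sequent n

equationExpr : Equation n → Expr n
equationExpr (s ≐ t) = (∼ s ⊔ t) ⊓ (∼ t ⊔ s)

-- Equations become biconditionals and hypotheses antecedents, so one truth table covers a whole
-- quasi-identity. A hypothesis that holds makes its biconditional `⊤`, which discharges it.
sequentExpr : Sequent n → Expr n
sequentExpr (⊢ e)   = equationExpr e
sequentExpr (h ⇛ s) = ∼ equationExpr h ⊔ sequentExpr s

truth : Vec Bool n → Expr n → Bool
truth bs (var i) = Vec.lookup bs i
truth bs (s ⊓ t) = truth bs s Bool.∧ truth bs t
truth bs (s ⊔ t) = truth bs s Bool.∨ truth bs t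
truth bs (∼ t)   = not (truth bs t)
truth bs 𝟙       = true
truth bs 𝟘       = false

forallVec : ∀ n → (Vec Bool n → Bool) → Bool
forallVec zero    p = p []
forallVec (suc n) p = forallVec n (λ bs → p (true ∷ bs)) Bool.∧
                      forallVec n (λ bs → p (false ∷ bs))

forallVec-sound : ∀ n p → T (forallVec n p) → ∀ bs → T (p bs)
forallVec-sound zero    p h []           = h
forallVec-sound (suc n) p h (true ∷ bs)  =
  forallVec-sound n _ (proj₁ (Equivalence.to T-∧ h)) bs
forallVec-sound (suc n) p h (false ∷ bs) =
  forallVec-sound n _ (proj₂ (Equivalence.to T-∧ h)) bs

Valid : Sequent n → Set
Valid {n} s = T (forallVec n (λ bs → truth bs (sequentExpr s)))

module BooleanSolver (B : BooleanAlgebra c ℓ) where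
  open BooleanAlgebra B
  open BooleanAlgebraProperties B
  open Poset poset using (_≤_)
  open OrderLatticeBundles.Lattice ∨-∧-orderTheoreticLattice
    using (antisym; x≤x∨y; y≤x∨y; ∨-least; x∧y≤x; x∧y≤y; ∧-greatest)
    renaming (trans to ≤-trans; reflexive to ≤-reflexive; refl to ≤-refl)

  ⟦_⟧ : Expr n → Vec Carrier n → Carrier
  ⟦ var i ⟧ ρ = Vec.lookup ρ i
  ⟦ s ⊓ t ⟧ ρ = ⟦ s ⟧ ρ ∧ ⟦ t ⟧ ρ
  ⟦ s ⊔ t ⟧ ρ = ⟦ s ⟧ ρ ∨ ⟦ t ⟧ ρ
  ⟦ ∼ t ⟧   ρ = ¬ ⟦ t ⟧ ρ
  ⟦ 𝟙 ⟧     ρ = ⊤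
  ⟦ 𝟘 ⟧     ρ = ⊥

  ⟦_⟧ᵉ : Equation n → Vec Carrier n → Set ℓ
  ⟦ s ≐ t ⟧ᵉ ρ = ⟦ s ⟧ ρ ≈ ⟦ t ⟧ ρ

  ⟦_⟧ˢ : Sequent n → Vec Carrier n → Set ℓ
  ⟦ ⊢ e ⟧ˢ   ρ = ⟦ e ⟧ᵉ ρ
  ⟦ h ⇛ s ⟧ˢ ρ = ⟦ h ⟧ᵉ ρ → ⟦ s ⟧ˢ ρ

  private
    -- The value of x is b on the part w of the algebra.
    data Is (w x : Carrier) : Bool → Set ℓ where
      holds : w ≤ x → Is w x true
      fails : w ≤ ¬ x → Is w x false

    Is-∧ : ∀ {w x y a b} → Is w x a → Is w y b → Is w (x ∧ y) (a Bool.∧ b)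
    Is-∧ (holds p) (holds q) = holds (∧-greatest p q)
    Is-∧ (holds p) (fails q) =
      fails (≤-trans q (≤-trans (y≤x∨y _ _) (≤-reflexive (sym (deMorgan₁ _ _)))))
    Is-∧ (fails p) _         =
      fails (≤-trans p (≤-trans (x≤x∨y _ _) (≤-reflexive (sym (deMorgan₁ _ _)))))

    Is-∨ : ∀ {w x y a b} → Is w x a → Is w y b → Is w (x ∨ y) (a Bool.∨ b)
    Is-∨ (holds p) _         = holds (≤-trans p (x≤x∨y _ _))
    Is-∨ (fails p) (holds q) = holds (≤-trans q (y≤x∨y _ _))
    Is-∨ (fails p) (fails q) =
      fails (≤-trans (∧-greatest p q) (≤-reflexive (sym (deMorgan₂ _ _))))

    Is-¬ : ∀ {w x b} → Is w x b → Is w (¬ x) (not b)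
    Is-¬ (holds p) = fails (≤-trans p (≤-reflexive (sym (¬-involutive _))))
    Is-¬ (fails p) = holds p

    Is-⟦⟧ : ∀ {w} {ρ : Vec Carrier n} {bs : Vec Bool n} → Pointwise (Is w) ρ bs →
            ∀ t → Is w (⟦ t ⟧ ρ) (truth bs t)
    Is-⟦⟧ ps (var i) = Pointwise.lookup ps i
    Is-⟦⟧ ps (s ⊓ t) = Is-∧ (Is-⟦⟧ ps s) (Is-⟦⟧ ps t)
    Is-⟦⟧ ps (s ⊔ t) = Is-∨ (Is-⟦⟧ ps s) (Is-⟦⟧ ps t)
    Is-⟦⟧ ps (∼ t)   = Is-¬ (Is-⟦⟧ ps t)
    Is-⟦⟧ ps 𝟙       = holds (sym (∧-identityʳ _))
    Is-⟦⟧ ps 𝟘       = fails (≤-trans (sym (∧-identityʳ _)) (≤-reflexive (sym ¬⊥≈⊤)))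

    split : ∀ w x → w ≤ (w ∧ x) ∨ (w ∧ ¬ x)
    split w x = ≤-reflexive (trans (sym (∧-identityʳ w))
      (trans (∧-congˡ (sym (∨-complementʳ x))) (∧-distribˡ-∨ w x (¬ x))))

    -- The minterms of ρ below w cover w.
    cover : ∀ {w z} (ρ : Vec Carrier n) →
            (∀ v (bs : Vec Bool n) → v ≤ w → Pointwise (Is v) ρ bs → v ≤ z) → w ≤ z
    cover {w = w} []      h = h w [] ≤-refl []
    cover {w = w} (x ∷ ρ) h = ≤-trans (split w x) (∨-least
      (cover ρ λ v bs v≤ ps → h v (true ∷ bs) (≤-trans v≤ (x∧y≤x _ _))
        (holds (≤-trans v≤ (x∧y≤y _ _)) ∷ ps))
      (cover ρ λ v bs v≤ ps → h v (false ∷ bs) (≤-trans v≤ (x∧y≤x _ _))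
        (fails (≤-trans v≤ (x∧y≤y _ _)) ∷ ps)))

    Is-true : ∀ {w x b} → T b → Is w x b → w ≤ x
    Is-true _ (holds p) = p

    modusPonens : ∀ {w x y} → w ≤ ¬ x ∨ y → w ≤ x → w ≤ y
    modusPonens {w} {x} {y} p q = ≤-trans (∧-greatest q p) (≤-trans
      (≤-reflexive (trans (∧-distribˡ-∨ x (¬ x) y)
        (trans (∨-congʳ (∧-complementʳ x)) (∨-identityˡ _))))
      (x∧y≤y x y))

    ⊤≤imp : ∀ {x y} → x ≤ y → ⊤ ≤ ¬ x ∨ y
    ⊤≤imp {x} {y} p = ≤-trans (≤-reflexive (sym (∨-complementˡ x)))
      (∨-least (x≤x∨y _ _) (≤-trans p (y≤x∨y _ _)))

    imp⇒≤ : ∀ {x y} → ⊤ ≤ ¬ x ∨ y → x ≤ y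
    imp⇒≤ p = modusPonens (≤-trans (sym (∧-identityʳ _)) p) ≤-refl

    equation⇒⊤ : ∀ (e : Equation n) ρ → ⟦ e ⟧ᵉ ρ → ⊤ ≤ ⟦ equationExpr e ⟧ ρ
    equation⇒⊤ (s ≐ t) ρ p =
      ∧-greatest (⊤≤imp (≤-reflexive p)) (⊤≤imp (≤-reflexive (sym p)))

    ⊤⇒sequent : ∀ (s : Sequent n) ρ → ⊤ ≤ ⟦ sequentExpr s ⟧ ρ → ⟦ s ⟧ˢ ρ
    ⊤⇒sequent (⊢ s ≐ t) ρ p = antisym (imp⇒≤ (≤-trans p (x∧y≤x _ _)))
                                      (imp⇒≤ (≤-trans p (x∧y≤y _ _)))
    ⊤⇒sequent (h ⇛ s)   ρ p q =
      ⊤⇒sequent s ρ (modusPonens p (equation⇒⊤ h ρ q))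

  -- For a tautology `Valid s` computes to the unit type, so the implicit argument is filled in by
  -- eta.
  entail : ∀ n (f : N-ary n (Expr n) (Sequent n)) →
           let s = f $ⁿ Vec.map var (Vec.allFin n) in
           (ρ : Vec Carrier n) {_ : Valid s} → ⟦ s ⟧ˢ ρ
  entail n f ρ {valid} = ⊤⇒sequent s ρ (cover ρ λ v bs _ ps →
      Is-true (forallVec-sound n _ valid bs) (Is-⟦⟧ ps (sequentExpr s)))
    where s = f $ⁿ Vec.map var (Vec.allFin n)

-- Basic properties of interior algebras

module InteriorProperties (A : InteriorAlgebra c ℓ) where
  open InteriorAlgebra A public
  open BooleanSolver booleanAlgebra public using (entail)
  module Opens = HeytingAlgebra (A °)

  ∧-open : ∀ {x y} → IsOpen x → IsOpen y → IsOpen (x ∧ y)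
  ∧-open ox oy = proj₂ ((_ , ox) Opens.∧ (_ , oy))

  ∨-open : ∀ {x y} → IsOpen x → IsOpen y → IsOpen (x ∨ y)
  ∨-open ox oy = proj₂ ((_ , ox) Opens.∨ (_ , oy))

  ⊥-open : IsOpen ⊥
  ⊥-open = proj₂ Opens.⊥

  g-open : ∀ {x} → IsOpen (g x)
  g-open = g-idem _

  IsOpen-resp : ∀ {x y} → x ≈ y → IsOpen x → IsOpen y
  IsOpen-resp x≈y ox = trans (g-cong (sym x≈y)) (trans ox x≈y)

  ≤-trans : ∀ {x y z} → x ≤ y → y ≤ z → x ≤ z
  ≤-trans = entail 3 (λ x y z → x ⊑ y ⇛ y ⊑ z ⇛ ⊢ x ⊑ z) (_ ∷ _ ∷ _ ∷ [])

  ≤-antisym : ∀ {x y} → x ≤ y → y ≤ x → x ≈ y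
  ≤-antisym = entail 2 (λ x y → x ⊑ y ⇛ y ⊑ x ⇛ ⊢ x ≐ y) (_ ∷ _ ∷ [])

  ≤-reflexive : ∀ {x y} → x ≈ y → x ≤ y
  ≤-reflexive = entail 2 (λ x y → x ≐ y ⇛ ⊢ x ⊑ y) (_ ∷ _ ∷ [])

  ≤-refl : ∀ {x} → x ≤ x
  ≤-refl = ≤-reflexive refl

  g-mono : ∀ {x y} → x ≤ y → g x ≤ g y
  g-mono x≤y = trans (g-cong x≤y) (g-∧ _ _)

  g-greatest : ∀ {o x} → IsOpen o → o ≤ x → o ≤ g x
  g-greatest oo o≤x = ≤-trans (≤-reflexive (sym oo)) (g-mono o≤x)

  -- `o ∧ g x` is open and lies below `y`. Below an open element, interiors thus depend only on what
  -- happens there.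
  g-local : ∀ {o x y} → IsOpen o → o ∧ x ≤ y → o ∧ g x ≤ g y
  g-local {o} {x} {y} oo p = g-greatest (∧-open oo g-open)
    (entail 4 (λ o x y gx → gx ⊑ x ⇛ o ⊓ x ⊑ y ⇛ ⊢ o ⊓ gx ⊑ y)
      (o ∷ x ∷ y ∷ g x ∷ []) (g-≤ x) p)

-- Normal forms and the extension of Heyting homomorphisms

module Clauses (A : InteriorAlgebra c ℓ) where
  open InteriorProperties A

  Open : Set (c ⊔ˡ ℓ)
  Open = Opens.Carrier

  -- The pair `(a , b)` encodes `¬ a ∨ b`, and a list of pairs the meet of its clauses.
  Clause : Set (c ⊔ˡ ℓ)
  Clause = Open × Open

  joinWith : Clause → List Clause → List Clause
  joinWith (a , b) = map λ (c , d) → a Opens.∧ c , b Opens.∨ d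

  join : List Clause → List Clause → List Clause
  join []      M = []
  join (p ∷ L) M = joinWith p M ++ join L M

  -- The negation of `¬ a ∨ b` is `a ∧ ¬ b`, the meet of the clauses `(⊤ , a)` and `(b , ⊥)`.
  complement : List Clause → List Clause
  complement []            = [ Opens.⊤ , Opens.⊥ ]
  complement ((a , b) ∷ L) =
    join ((Opens.⊤ , a) ∷ (b , Opens.⊥) ∷ []) (complement L)

  interior : List Clause → Open
  interior []            = Opens.⊤
  interior ((a , b) ∷ L) = (a Opens.⇨ b) Opens.∧ interior L

-- Clauses over `A` are read in `B` through `k`. With `k` the identity this gives normal forms in
-- `A`; with a general `k` it gives the extension of `k`.
module Value (A : InteriorAlgebra c₁ ℓ₁) (B : InteriorAlgebra c₂ ℓ₂)
             (k : HeytingHom (A °) (B °)) where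
  open Clauses A
  open InteriorProperties B
  private
    module A = InteriorProperties A
    module k = HeytingHom k

  ⟪_⟫ : Open → Carrier
  ⟪ a ⟫ = proj₁ k.⟦ a ⟧

  value : List Clause → Carrier
  value []            = ⊤
  value ((a , b) ∷ L) = (¬ ⟪ a ⟫ ∨ ⟪ b ⟫) ∧ value L

  value-[_] : ∀ a → value [ A.Opens.⊤ , a ] ≈ ⟪ a ⟫
  value-[ a ] = entail 2 (λ t a → t ≐ 𝟙 ⇛ ⊢ (∼ t ⊔ a) ⊓ 𝟙 ≐ a) (_ ∷ _ ∷ []) k.⊤-homo

  value-++ : ∀ L M → value (L ++ M) ≈ value L ∧ value M
  value-++ []      M = entail 1 (λ m → ⊢ m ≐ 𝟙 ⊓ m) (_ ∷ [])
  value-++ (p ∷ L) M = trans (∧-congˡ (value-++ L M)) (sym (∧-assoc _ _ _))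

  value-joinWith : ∀ a b M →
    value (joinWith (a , b) M) ≈ (¬ ⟪ a ⟫ ∨ ⟪ b ⟫) ∨ value M
  value-joinWith a b []            = entail 1 (λ m → ⊢ 𝟙 ≐ m ⊔ 𝟙) (_ ∷ [])
  value-joinWith a b ((c , d) ∷ M) = trans
    (∧-cong (∨-cong (¬-cong (k.∧-homo a c)) (k.∨-homo b d)) (value-joinWith a b M))
    (entail 5 (λ a b c d m → ⊢ (∼ (a ⊓ c) ⊔ (b ⊔ d)) ⊓ ((∼ a ⊔ b) ⊔ m) ≐
                               (∼ a ⊔ b) ⊔ ((∼ c ⊔ d) ⊓ m))
      (_ ∷ _ ∷ _ ∷ _ ∷ _ ∷ []))

  value-join : ∀ L M → value (join L M) ≈ value L ∨ value M
  value-join []            M = entail 1 (λ m → ⊢ 𝟙 ≐ 𝟙 ⊔ m) (_ ∷ [])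
  value-join ((a , b) ∷ L) M = trans (value-++ (joinWith (a , b) M) (join L M))
    (trans (∧-cong (value-joinWith a b M) (value-join L M))
      (entail 3 (λ p l m → ⊢ (p ⊔ m) ⊓ (l ⊔ m) ≐ (p ⊓ l) ⊔ m) (_ ∷ _ ∷ _ ∷ [])))

  value-complement : ∀ L → value (complement L) ≈ ¬ value L
  value-complement []            =
    entail 2 (λ t b → t ≐ 𝟙 ⇛ b ≐ 𝟘 ⇛ ⊢ (∼ t ⊔ b) ⊓ 𝟙 ≐ ∼ 𝟙) (_ ∷ _ ∷ [])
      k.⊤-homo k.⊥-homo
  value-complement ((a , b) ∷ L) =
    trans (value-join ((A.Opens.⊤ , a) ∷ (b , A.Opens.⊥) ∷ []) (complement L))
      (trans (∨-congˡ (value-complement L))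
        (entail 5 (λ t z a b l → t ≐ 𝟙 ⇛ z ≐ 𝟘 ⇛
            ⊢ ((∼ t ⊔ a) ⊓ (∼ b ⊔ z) ⊓ 𝟙) ⊔ ∼ l ≐ ∼ ((∼ a ⊔ b) ⊓ l))
          (_ ∷ _ ∷ _ ∷ _ ∷ _ ∷ []) k.⊤-homo k.⊥-homo))

  value-interior : ∀ L → g (value L) ≈ ⟪ interior L ⟫
  value-interior []            = trans g-⊤ (sym k.⊤-homo)
  value-interior ((a , b) ∷ L) = trans (g-∧ _ _) (trans
    (∧-cong (sym (k.⇨-homo a b)) (value-interior L)) (sym (k.∧-homo _ _)))

module NormalForm (A : InteriorAlgebra c ℓ) where
  open Clauses A
  open InteriorProperties A
  open Value A A (Category.id (HA (c ⊔ˡ ℓ) ℓ ℓ) {A °}) public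

  normalForm : ∀ {x} → Sg A IsOpen x → ∃ λ L → value L ≈ x
  normalForm (base ox) = [ Opens.⊤ , (_ , ox) ] , value-[ _ , ox ]
  normalForm (resp x≈y s) =
    let L , p = normalForm s in L , trans p x≈y
  normalForm (∨-clos s t) =
    let L , p = normalForm s ; M , q = normalForm t
    in join L M , trans (value-join L M) (∨-cong p q)
  normalForm (∧-clos s t) =
    let L , p = normalForm s ; M , q = normalForm t
    in L ++ M , trans (value-++ L M) (∧-cong p q)
  normalForm (¬-clos s) =
    let L , p = normalForm s in complement L , trans (value-complement L) (¬-cong p)
  normalForm (g-clos s) =
    let L , p = normalForm s
    in [ Opens.⊤ , interior L ] ,
       trans value-[ interior L ] (trans (sym (value-interior L)) (g-cong p))
  normalForm ⊤-clos = [] , refl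
  normalForm ⊥-clos = [ Opens.⊤ , Opens.⊥ ] , value-[ Opens.⊥ ]

module Extension (A : InteriorAlgebra c₁ ℓ₁) (B : InteriorAlgebra c₂ ℓ₂)
                 (k : HeytingHom (A °) (B °)) where
  open Clauses A
  open InteriorProperties B
  open Value A B k
  private
    module A = InteriorProperties A
    module NF = NormalForm A
    module k = HeytingHom k

  ⟪⟫-mono : ∀ {a b} → a A.Opens.≤ b → ⟪ a ⟫ ≤ ⟪ b ⟫
  ⟪⟫-mono a≤b = trans (k.cong a≤b) (k.∧-homo _ _)

  -- A clause `¬ a ∨ b` on the left is traded for two inequalities, one with `b` met into `c` and
  -- one with `a` joined to `d`. In the end only an inequality between open elements is left, and
  -- `k` preserves it.
  value-∧-mono : ∀ L c d → NF.value L A.∧ proj₁ c A.≤ proj₁ d →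
                 value L ∧ ⟪ c ⟫ ≤ ⟪ d ⟫
  value-∧-mono [] c d p =
    entail 2 (λ c d → c ⊑ d ⇛ ⊢ 𝟙 ⊓ c ⊑ d) (_ ∷ _ ∷ [])
      (⟪⟫-mono (A.entail 2 (λ c d → 𝟙 ⊓ c ⊑ d ⇛ ⊢ c ⊑ d) (_ ∷ _ ∷ []) p))
  value-∧-mono ((a , b) ∷ L) c d p =
    entail 7 (λ a b c d cb da l → l ⊓ cb ⊑ d ⇛ l ⊓ c ⊑ da ⇛ cb ≐ c ⊓ b ⇛ da ≐ d ⊔ a ⇛
        ⊢ ((∼ a ⊔ b) ⊓ l) ⊓ c ⊑ d)
      (_ ∷ _ ∷ _ ∷ _ ∷ _ ∷ _ ∷ _ ∷ [])
      (value-∧-mono L (c A.Opens.∧ b) d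
        (A.entail 5 (λ a b c d l → ((∼ a ⊔ b) ⊓ l) ⊓ c ⊑ d ⇛ ⊢ l ⊓ (c ⊓ b) ⊑ d)
          (_ ∷ _ ∷ _ ∷ _ ∷ _ ∷ []) p))
      (value-∧-mono L c (d A.Opens.∨ a)
        (A.entail 5 (λ a b c d l → ((∼ a ⊔ b) ⊓ l) ⊓ c ⊑ d ⇛ ⊢ l ⊓ c ⊑ d ⊔ a)
          (_ ∷ _ ∷ _ ∷ _ ∷ _ ∷ []) p))
      (k.∧-homo c b) (k.∨-homo d a)

  value-mono : ∀ L M → NF.value L A.≤ NF.value M → value L ≤ value M
  value-mono L [] p = entail 1 (λ l → ⊢ l ⊑ 𝟙) (_ ∷ [])
  value-mono L ((a , b) ∷ M) p =
    entail 4 (λ l a b m → l ⊓ a ⊑ b ⇛ l ⊑ m ⇛ ⊢ l ⊑ (∼ a ⊔ b) ⊓ m)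
      (_ ∷ _ ∷ _ ∷ _ ∷ [])
      (value-∧-mono L a b
        (A.entail 4 (λ l a b m → l ⊑ (∼ a ⊔ b) ⊓ m ⇛ ⊢ l ⊓ a ⊑ b)
          (_ ∷ _ ∷ _ ∷ _ ∷ []) p))
      (value-mono L M
        (A.entail 4 (λ l a b m → l ⊑ (∼ a ⊔ b) ⊓ m ⇛ ⊢ l ⊑ m)
          (_ ∷ _ ∷ _ ∷ _ ∷ []) p))

  value-cong : ∀ L M → NF.value L A.≈ NF.value M → value L ≈ value M
  value-cong L M p = ≤-antisym (value-mono L M (A.≤-reflexive p))
                               (value-mono M L (A.≤-reflexive (A.sym p)))

  module _ (star : IsStarAlgebra A) where
    private
      nf : A.Carrier → List Clause
      nf x = proj₁ (NF.normalForm (star x))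

      nf-value : ∀ x → NF.value (nf x) A.≈ x
      nf-value x = proj₂ (NF.normalForm (star x))

      nf-unique : ∀ L {x} → NF.value L A.≈ x → value (nf x) ≈ value L
      nf-unique L p = value-cong (nf _) L (A.trans (nf-value _) (A.sym p))

    -- By `value-cong` any normal form of an element gives the same value in `B`. Each operation on
    -- lists yields a normal form of the result, and its value in `B` is already computed.
    extension : InteriorHom A B
    extension = record
      { ⟦_⟧    = λ x → value (nf x)
      ; cong   = λ x≈y → nf-unique (nf _) (A.trans (nf-value _) (A.sym x≈y))
      ; ∨-homo = λ x y → trans
          (nf-unique (join (nf x) (nf y))
            (A.trans (NF.value-join (nf x) (nf y)) (A.∨-cong (nf-value x) (nf-value y))))
          (value-join (nf x) (nf y))
      ; ∧-homo = λ x y → trans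
          (nf-unique (nf x ++ nf y)
            (A.trans (NF.value-++ (nf x) (nf y)) (A.∧-cong (nf-value x) (nf-value y))))
          (value-++ (nf x) (nf y))
      ; ¬-homo = λ x → trans
          (nf-unique (complement (nf x))
            (A.trans (NF.value-complement (nf x)) (A.¬-cong (nf-value x))))
          (value-complement (nf x))
      ; ⊤-homo = nf-unique [] A.refl
      ; ⊥-homo = trans
          (nf-unique [ A.Opens.⊤ , A.Opens.⊥ ] NF.value-[ A.Opens.⊥ ])
          (trans value-[ A.Opens.⊥ ] k.⊥-homo)
      ; g-homo = λ x → trans
          (nf-unique [ A.Opens.⊤ , interior (nf x) ]
            (A.trans NF.value-[ interior (nf x) ]
              (A.trans (A.sym (NF.value-interior (nf x))) (A.g-cong (nf-value x)))))
          (trans value-[ interior (nf x) ] (sym (value-interior (nf x))))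
      }

    extension-extends : ∀ a → InteriorHom.⟦ extension ⟧ (proj₁ a) ≈ ⟪ a ⟫
    extension-extends a =
      trans (nf-unique [ A.Opens.⊤ , a ] NF.value-[ a ]) value-[ a ]

-- Subalgebras and powers

module _ {A : InteriorAlgebra c₁ ℓ₁} {B : InteriorAlgebra c₂ ℓ₂} (h : InteriorHom A B) where
  private
    module A = InteriorAlgebra A
  open InteriorAlgebra B
  open InteriorHom h

  eval-homo : ∀ ρ t → ⟦ eval A ρ t ⟧ ≈ eval B (λ n → ⟦ ρ n ⟧) t
  eval-homo ρ (Term.var n) = refl
  eval-homo ρ (s Term.∨ t) = trans (∨-homo _ _) (∨-cong (eval-homo ρ s) (eval-homo ρ t))
  eval-homo ρ (s Term.∧ t) = trans (∧-homo _ _) (∧-cong (eval-homo ρ s) (eval-homo ρ t))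
  eval-homo ρ (Term.¬ t)   = trans (¬-homo _) (¬-cong (eval-homo ρ t))
  eval-homo ρ (Term.g t)   = trans (g-homo _) (g-cong (eval-homo ρ t))
  eval-homo ρ Term.⊤       = ⊤-homo
  eval-homo ρ Term.⊥       = ⊥-homo

  Sg-homo : {S : Pred A.Carrier p} {T : Pred Carrier q} →
            (∀ {x} → S x → T ⟦ x ⟧) → ∀ {x} → Sg A S x → Sg B T ⟦ x ⟧
  Sg-homo f (base s)     = base (f s)
  Sg-homo f (resp eq s)  = resp (cong eq) (Sg-homo f s)
  Sg-homo f (∨-clos s t) = resp (sym (∨-homo _ _)) (∨-clos (Sg-homo f s) (Sg-homo f t))
  Sg-homo f (∧-clos s t) = resp (sym (∧-homo _ _)) (∧-clos (Sg-homo f s) (Sg-homo f t))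
  Sg-homo f (¬-clos s)   = resp (sym (¬-homo _)) (¬-clos (Sg-homo f s))
  Sg-homo f (g-clos s)   = resp (sym (g-homo _)) (g-clos (Sg-homo f s))
  Sg-homo f ⊤-clos       = resp (sym ⊤-homo) ⊤-clos
  Sg-homo f ⊥-clos       = resp (sym ⊥-homo) ⊥-clos

  hom-open : ∀ {x} → A.IsOpen x → IsOpen ⟦ x ⟧
  hom-open ox = trans (sym (g-homo _)) (cong ox)

  hom-unique : (h′ : InteriorHom A B) {S : Pred A.Carrier p} →
               (∀ {x} → S x → ⟦ x ⟧ ≈ InteriorHom.⟦ h′ ⟧ x) →
               ∀ {x} → Sg A S x → ⟦ x ⟧ ≈ InteriorHom.⟦ h′ ⟧ x
  hom-unique h′ {S} f = go
    where
    module h′ = InteriorHom h′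
    go : ∀ {x} → Sg A S x → ⟦ x ⟧ ≈ h′.⟦ x ⟧
    go (base s)     = f s
    go (resp eq s)  = trans (cong (A.sym eq)) (trans (go s) (h′.cong eq))
    go (∨-clos s t) = trans (∨-homo _ _) (trans (∨-cong (go s) (go t)) (sym (h′.∨-homo _ _)))
    go (∧-clos s t) = trans (∧-homo _ _) (trans (∧-cong (go s) (go t)) (sym (h′.∧-homo _ _)))
    go (¬-clos s)   = trans (¬-homo _) (trans (¬-cong (go s)) (sym (h′.¬-homo _)))
    go (g-clos s)   = trans (g-homo _) (trans (g-cong (go s)) (sym (h′.g-homo _)))
    go ⊤-clos       = trans ⊤-homo (sym h′.⊤-homo)
    go ⊥-clos       = trans ⊥-homo (sym h′.⊥-homo)

-- A jointly injective family serves both closure properties: one inclusion for subalgebras, all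
-- projections for powers.
Models-reflect : {V : Variety ℓ} {A B : InteriorAlgebra ℓ ℓ} {I : Set i}
                 (h : I → InteriorHom A B) →
                 (let open InteriorHom in ∀ {x y} →
                   (∀ j → InteriorAlgebra._≈_ B (⟦ h j ⟧ x) (⟦ h j ⟧ y)) →
                   InteriorAlgebra._≈_ A x y) →
                 Models V B → Models V A
Models-reflect {A = A} {B = B} h injective models {s} {t} eq ρ = injective λ j →
  B.trans (eval-homo (h j) ρ s) (B.trans (models eq _) (B.sym (eval-homo (h j) ρ t)))
  where module B = InteriorAlgebra B

module _ (A : InteriorAlgebra c ℓ) where
  open InteriorProperties A

  subalgebra : Pred Carrier p → InteriorAlgebra (c ⊔ˡ ℓ ⊔ˡ p) ℓ
  subalgebra S = record
    { booleanAlgebra = record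
      { Carrier = Σ Carrier (Sg A S)
      ; _≈_ = _≈_ on proj₁
      ; _∨_ = λ (x , s) (y , t) → x ∨ y , ∨-clos s t
      ; _∧_ = λ (x , s) (y , t) → x ∧ y , ∧-clos s t
      ; ¬_  = λ (x , s) → ¬ x , ¬-clos s
      ; ⊤   = ⊤ , ⊤-clos
      ; ⊥   = ⊥ , ⊥-clos
      ; isBooleanAlgebra = record
        { isDistributiveLattice = record
          { isLattice = record
            { isEquivalence = record { refl = refl ; sym = sym ; trans = trans }
            ; ∨-comm  = λ _ _ → ∨-comm _ _
            ; ∨-assoc = λ _ _ _ → ∨-assoc _ _ _
            ; ∨-cong  = ∨-cong
            ; ∧-comm  = λ _ _ → ∧-comm _ _
            ; ∧-assoc = λ _ _ _ → ∧-assoc _ _ _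
            ; ∧-cong  = ∧-cong
            ; absorptive = (λ _ _ → ∨-absorbs-∧ _ _) , (λ _ _ → ∧-absorbs-∨ _ _)
            }
          ; ∨-distrib-∧ = (λ _ _ _ → ∨-distribˡ-∧ _ _ _) , (λ _ _ _ → ∨-distribʳ-∧ _ _ _)
          ; ∧-distrib-∨ = (λ _ _ _ → ∧-distribˡ-∨ _ _ _) , (λ _ _ _ → ∧-distribʳ-∨ _ _ _)
          }
        ; ∨-complement = (λ _ → ∨-complementˡ _) , (λ _ → ∨-complementʳ _)
        ; ∧-complement = (λ _ → ∧-complementˡ _) , (λ _ → ∧-complementʳ _)
        ; ¬-cong = ¬-cong
        }
      }
    ; g      = λ (x , s) → g x , g-clos s
    ; g-cong = g-cong
    ; g-⊤    = g-⊤
    ; g-∧    = λ _ _ → g-∧ _ _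
    ; g-≤    = λ _ → g-≤ _
    ; g-idem = λ _ → g-idem _
    }

  inclusion : (S : Pred Carrier p) → InteriorHom (subalgebra S) A
  inclusion S = record
    { ⟦_⟧    = proj₁
    ; cong   = id
    ; ∨-homo = λ _ _ → refl
    ; ∧-homo = λ _ _ → refl
    ; ¬-homo = λ _ → refl
    ; ⊤-homo = refl
    ; ⊥-homo = refl
    ; g-homo = λ _ → refl
    }

  subalgebra-generated : {S : Pred Carrier p}
    {T : Pred (InteriorAlgebra.Carrier (subalgebra S)) q} →
    (∀ {x} (s : S x) → T (x , base s)) → Generates (subalgebra S) T
  subalgebra-generated {S = S} {T} f (_ , s) = go s
    where
    go : ∀ {x} (s : Sg A S x) → Sg (subalgebra S) T (x , s)
    go (base s)     = base (f s)
    go (resp eq s)  = resp eq (go s)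
    go (∨-clos s t) = ∨-clos (go s) (go t)
    go (∧-clos s t) = ∧-clos (go s) (go t)
    go (¬-clos s)   = ¬-clos (go s)
    go (g-clos s)   = g-clos (go s)
    go ⊤-clos       = ⊤-clos
    go ⊥-clos       = ⊥-clos

  power : Set i → InteriorAlgebra (c ⊔ˡ i) (ℓ ⊔ˡ i)
  power I = record
    { booleanAlgebra = record
      { Carrier = I → Carrier
      ; _≈_ = λ x y → ∀ j → x j ≈ y j
      ; _∨_ = λ x y j → x j ∨ y j
      ; _∧_ = λ x y j → x j ∧ y j
      ; ¬_  = λ x j → ¬ x j
      ; ⊤   = λ _ → ⊤
      ; ⊥   = λ _ → ⊥
      ; isBooleanAlgebra = record
        { isDistributiveLattice = record
          { isLattice = record
            { isEquivalence = record
              { refl  = λ _ → refl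
              ; sym   = λ p j → sym (p j)
              ; trans = λ p q j → trans (p j) (q j)
              }
            ; ∨-comm  = λ _ _ _ → ∨-comm _ _
            ; ∨-assoc = λ _ _ _ _ → ∨-assoc _ _ _
            ; ∨-cong  = λ p q j → ∨-cong (p j) (q j)
            ; ∧-comm  = λ _ _ _ → ∧-comm _ _
            ; ∧-assoc = λ _ _ _ _ → ∧-assoc _ _ _
            ; ∧-cong  = λ p q j → ∧-cong (p j) (q j)
            ; absorptive = (λ _ _ _ → ∨-absorbs-∧ _ _) , (λ _ _ _ → ∧-absorbs-∨ _ _)
            }
          ; ∨-distrib-∧ = (λ _ _ _ _ → ∨-distribˡ-∧ _ _ _) , (λ _ _ _ _ → ∨-distribʳ-∧ _ _ _)
          ; ∧-distrib-∨ = (λ _ _ _ _ → ∧-distribˡ-∨ _ _ _) , (λ _ _ _ _ → ∧-distribʳ-∨ _ _ _)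
          }
        ; ∨-complement = (λ _ _ → ∨-complementˡ _) , (λ _ _ → ∨-complementʳ _)
        ; ∧-complement = (λ _ _ → ∧-complementˡ _) , (λ _ _ → ∧-complementʳ _)
        ; ¬-cong = λ p j → ¬-cong (p j)
        }
      }
    ; g      = λ x j → g (x j)
    ; g-cong = λ p j → g-cong (p j)
    ; g-⊤    = λ _ → g-⊤
    ; g-∧    = λ _ _ _ → g-∧ _ _
    ; g-≤    = λ _ _ → g-≤ _
    ; g-idem = λ _ _ → g-idem _
    }

  projection : {I : Set i} → I → InteriorHom (power I) A
  projection j = record
    { ⟦_⟧    = λ x → x j
    ; cong   = λ p → p j
    ; ∨-homo = λ _ _ → refl
    ; ∧-homo = λ _ _ → refl
    ; ¬-homo = λ _ → refl
    ; ⊤-homo = refl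
    ; ⊥-homo = refl
    ; g-homo = λ _ → refl
    }

-- The Grzegorczyk inequality

module Grzegorczyk (A : InteriorAlgebra c ℓ) where
  open Clauses A
  open InteriorProperties A
  open NormalForm A

  -- The antecedent of the modal Grzegorczyk axiom `□ (□ (p → □ p) → p) → p`, with `g` as the box.
  grz : Carrier → Carrier
  grz x = g (¬ g (¬ x ∨ g x) ∨ x)

  IsGrz : Set (c ⊔ˡ ℓ)
  IsGrz = ∀ x → grz x ≤ x

  grz-cong : ∀ {x y} → x ≈ y → grz x ≈ grz y
  grz-cong p = g-cong (∨-cong (¬-cong (g-cong (∨-cong (¬-cong p) (g-cong p)))) p)

  -- One use of `g-local` for each nested `g`; both hypotheses are needed because `x` occurs with
  -- both signs.
  grz-local : ∀ {o x y} → IsOpen o → o ∧ x ≤ y → o ∧ y ≤ x → o ∧ grz x ≤ grz y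
  grz-local {o} {x} {y} oo p q = g-local oo
    (entail 5 (λ o x y bx by → o ⊓ x ⊑ y ⇛ o ⊓ by ⊑ bx ⇛ ⊢ o ⊓ (∼ bx ⊔ x) ⊑ ∼ by ⊔ y)
      (_ ∷ _ ∷ _ ∷ _ ∷ _ ∷ []) p
      (g-local oo
        (entail 5 (λ o x y gx gy → o ⊓ x ⊑ y ⇛ o ⊓ gy ⊑ gx ⇛ ⊢ o ⊓ (∼ y ⊔ gy) ⊑ ∼ x ⊔ gx)
          (_ ∷ _ ∷ _ ∷ _ ∷ _ ∷ []) p (g-local oo q))))

  grz-open : ∀ {x} → IsOpen x → grz x ≤ x
  grz-open {x} ox = ≤-trans (g-≤ _)
    (entail 2 (λ b x → b ≐ 𝟙 ⇛ ⊢ ∼ b ⊔ x ⊑ x) (_ ∷ _ ∷ [])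
      (trans (g-cong (entail 2 (λ x gx → gx ≐ x ⇛ ⊢ ∼ x ⊔ gx ≐ 𝟙) (_ ∷ _ ∷ []) ox)) g-⊤))

  grz-value : ∀ L → grz (value L) ≤ value L
  grz-value []            = entail 1 (λ y → ⊢ y ⊑ 𝟙) (_ ∷ [])
  grz-value (((a , oa) , (b , ob)) ∷ L) =
    entail 4 (λ a b v y → y ⊓ a ⊑ b ⇛ y ⊓ y ⊑ v ⇛ ⊢ y ⊑ (∼ a ⊔ b) ⊓ v) (_ ∷ _ ∷ _ ∷ _ ∷ [])
      y∧a≤b
      -- Now `x` agrees with `v` on the open element `y` itself, so the induction hypothesis bounds
      -- `y ∧ grz x`, which is `y`.
      (≤-trans (grz-local g-open
          (entail 4 (λ a b v y → ⊢ y ⊓ ((∼ a ⊔ b) ⊓ v) ⊑ v) (a ∷ b ∷ v ∷ y ∷ []))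
          (entail 4 (λ a b v y → y ⊓ a ⊑ b ⇛ ⊢ y ⊓ v ⊑ (∼ a ⊔ b) ⊓ v) (_ ∷ _ ∷ _ ∷ _ ∷ []) y∧a≤b))
        (grz-value L))
    where
    v x y : Carrier
    v = value L
    x = (¬ a ∨ b) ∧ v
    y = grz x

    -- x agrees with v on b, so the induction hypothesis applies there.
    b∧y≤v : b ∧ y ≤ v
    b∧y≤v = ≤-trans (grz-local ob
        (entail 3 (λ a b v → ⊢ b ⊓ ((∼ a ⊔ b) ⊓ v) ⊑ v) (_ ∷ _ ∷ _ ∷ []))
        (entail 3 (λ a b v → ⊢ b ⊓ v ⊑ (∼ a ⊔ b) ⊓ v) (_ ∷ _ ∷ _ ∷ [])))
      (grz-value L)

    -- Hence x agrees with the open element b on y ∧ a.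
    y∧a≤b : y ∧ a ≤ b
    y∧a≤b = entail 3 (λ a b y → (y ⊓ a) ⊓ y ⊑ b ⇛ ⊢ y ⊓ a ⊑ b) (_ ∷ _ ∷ _ ∷ [])
      (≤-trans (grz-local (∧-open g-open oa)
          (entail 4 (λ a b v y → ⊢ (y ⊓ a) ⊓ ((∼ a ⊔ b) ⊓ v) ⊑ b) (a ∷ b ∷ v ∷ y ∷ []))
          (entail 4 (λ a b v y → b ⊓ y ⊑ v ⇛ ⊢ (y ⊓ a) ⊓ b ⊑ (∼ a ⊔ b) ⊓ v)
            (_ ∷ _ ∷ _ ∷ _ ∷ []) b∧y≤v))
        (grz-open ob))

  star⇒grz : IsStarAlgebra A → IsGrz
  star⇒grz star x =
    let L , p = normalForm (star x)
    in ≤-trans (≤-reflexive (grz-cong (sym p))) (≤-trans (grz-value L) (≤-reflexive p))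

  -- Outside o, every point of e would see both x and ¬ x outside o, contradicting
  -- the Grzegorczyk inequality for o ∨ x.
  grz-dense : IsGrz → ∀ {e o} x → IsOpen e → IsOpen o →
              e ∧ g (o ∨ x) ≤ o → e ∧ g (o ∨ ¬ x) ≤ o → e ≤ o
  grz-dense isGrz {e} {o} x oe oo p q =
    entail 3 (λ e o gz → e ⊑ gz ⇛ e ⊓ gz ⊑ o ⇛ ⊢ e ⊑ o) (_ ∷ _ ∷ _ ∷ [])
      (g-greatest oe (≤-trans e≤grz (isGrz z))) p
    where
    z : Carrier
    z = o ∨ x

    local : e ∧ g (¬ z ∨ g z) ≤ g (o ∨ ¬ x)
    local = g-local oe
      (entail 4 (λ e o x gz → e ⊓ gz ⊑ o ⇛ ⊢ e ⊓ (∼ (o ⊔ x) ⊔ gz) ⊑ o ⊔ ∼ x)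
        (_ ∷ _ ∷ _ ∷ _ ∷ []) p)

    e≤grz : e ≤ grz z
    e≤grz = g-greatest oe
      (entail 5 (λ e o x b d → e ⊓ b ⊑ d ⇛ e ⊓ d ⊑ o ⇛ ⊢ e ⊑ ∼ b ⊔ (o ⊔ x))
        (_ ∷ _ ∷ _ ∷ _ ∷ _ ∷ []) local q)

-- Finite algebras satisfying the inequality

module _ (A : InteriorAlgebra c ℓ) where
  open InteriorProperties A
  open Grzegorczyk A

  sequence-mono : (o : ℕ → Carrier) → (∀ n → o n ≤ o (suc n)) →
                  ∀ {m n} → m ℕ.≤ n → o m ≤ o n
  sequence-mono o step m≤n = go (ℕ.≤⇒≤′ m≤n)
    where
    go : ∀ {m n} → m ℕ.≤′ n → o m ≤ o n
    go (ℕ.≤′-reflexive ≡.refl) = ≤-refl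
    go (ℕ.≤′-step m≤n)         = ≤-trans (go m≤n) (step _)

  -- Among the first `n + 1` terms two are equal, at indices `j < k`, so `o (suc j) ≤ o k ≈ o j`.
  finite⇒stabilises : IsFinite A → (o : ℕ → Carrier) → (∀ n → o n ≤ o (suc n)) →
                      ∃ λ n → o (suc n) ≤ o n
  finite⇒stabilises (n , inverse) o step =
    let j , k , j<k , eq = pigeonhole (ℕ.n<1+n n) (λ j → from (o (toℕ j)))
    in toℕ j , ≤-trans (sequence-mono o step j<k) (≤-reflexive
         (trans (sym (strictlyInverseˡ _))
           (trans (reflexive (≡.cong to (≡.sym eq))) (strictlyInverseˡ _))))
    where
    open Inverse inverse

  module _ (x : Carrier) where
    peel : ℕ → Carrier
    peel zero    = ⊥
    peel (suc n) = peel n ∨ (g (peel n ∨ x) ∨ g (peel n ∨ ¬ x))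

    peel-open : ∀ n → IsOpen (peel n)
    peel-open zero    = ⊥-open
    peel-open (suc n) = ∨-open (peel-open n) (∨-open g-open g-open)

    -- Outside the old stage, `g (peel n ∨ x)` lies inside `x` and `g (peel n ∨ ¬ x)` misses it, so
    -- the new part of `x` is a difference of two open elements.
    peel-generated : ∀ n → Sg A IsOpen (x ∧ peel n)
    peel-generated zero    = resp (entail 1 (λ x → ⊢ 𝟘 ≐ x ⊓ 𝟘) (_ ∷ [])) ⊥-clos
    peel-generated (suc n) =
      resp (entail 4 (λ x o u v → u ⊑ o ⊔ x ⇛ v ⊑ o ⊔ ∼ x ⇛
              ⊢ (x ⊓ o) ⊔ (u ⊓ ∼ o) ≐ x ⊓ (o ⊔ (u ⊔ v)))
             (_ ∷ _ ∷ _ ∷ _ ∷ []) (g-≤ _) (g-≤ _))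
        (∨-clos (peel-generated n) (∧-clos (base g-open) (¬-clos (base (peel-open n)))))

  finite-grz⇒star : IsFinite A → IsGrz → IsStarAlgebra A
  finite-grz⇒star finite isGrz x =
    let n , stable = finite⇒stabilises finite (peel x) λ n →
          entail 2 (λ o u → ⊢ o ⊑ o ⊔ u) (_ ∷ _ ∷ [])
        ⊤≤o = grz-dense isGrz x g-⊤ (peel-open x n)
          (entail 3 (λ o u v → o ⊔ (u ⊔ v) ⊑ o ⇛ ⊢ 𝟙 ⊓ u ⊑ o) (_ ∷ _ ∷ _ ∷ []) stable)
          (entail 3 (λ o u v → o ⊔ (u ⊔ v) ⊑ o ⇛ ⊢ 𝟙 ⊓ v ⊑ o) (_ ∷ _ ∷ _ ∷ []) stable)
    in resp (entail 2 (λ x o → 𝟙 ⊑ o ⇛ ⊢ x ⊓ o ≐ x) (_ ∷ _ ∷ []) ⊤≤o) (peel-generated x n)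

-- Since `≤` unfolds to an identity, the inequality passes from the generating *-algebras to the
-- whole variety.
grzVariety : ∀ ℓ → Variety ℓ
grzVariety ℓ = record
  { Identity = λ s t → Lift ℓ (s ≡ grzTerm × t ≡ grzTerm Term.∧ x) }
  where
  x grzTerm : Defs.Term
  x       = Term.var 0
  grzTerm = Term.g ((Term.¬ Term.g ((Term.¬ x) Term.∨ Term.g x)) Term.∨ x)

Models-grz⇒IsGrz : {A : InteriorAlgebra ℓ ℓ} → Models (grzVariety ℓ) A → Grzegorczyk.IsGrz A
Models-grz⇒IsGrz models x = models (lift (≡.refl , ≡.refl)) (λ _ → x)

IsGrz⇒Models-grz : {A : InteriorAlgebra ℓ ℓ} → Grzegorczyk.IsGrz A → Models (grzVariety ℓ) A
IsGrz⇒Models-grz isGrz (lift (≡.refl , ≡.refl)) ρ = isGrz (ρ 0)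

-- Varieties consisting of *-algebras

AllStar : Variety ℓ → Set (Level.suc ℓ)
AllStar V = ∀ A → Models V A → IsStarAlgebra A

-- It suffices to treat `x` inside the subalgebra it generates, which is finite and satisfies the
-- inequality; open elements there are open in `A`.
locallyFinite-star⇒allStar : (V : Variety ℓ) → IsLocallyFinite V → IsStarVariety V → AllStar V
locallyFinite-star⇒allStar V locallyFinite (_ , generated) A mA x =
  Sg-homo (inclusion A S) (λ {y} → hom-open (inclusion A S) {y})
    (finite-grz⇒star ⟨x⟩ (locallyFinite ⟨x⟩ m⟨x⟩ finitelyGenerated) isGrz (x , base refl))
  where
  open InteriorAlgebra A
  S = x ≈_
  ⟨x⟩ = subalgebra A S

  m⟨x⟩ : Models V ⟨x⟩
  m⟨x⟩ = Models-reflect {V = V} {⟨x⟩} {A} {I = Fin 1}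
    (λ _ → inclusion A S) (λ eq → eq Fin.zero) mA

  finitelyGenerated : IsFinitelyGenerated ⟨x⟩
  finitelyGenerated = 1 , (λ _ → x , base refl) ,
    subalgebra-generated A (λ x≈y → Fin.zero , x≈y)

  isGrz : Grzegorczyk.IsGrz ⟨x⟩
  isGrz = Models-grz⇒IsGrz {A = ⟨x⟩} (generated (grzVariety _)
    (λ B (_ , star) → IsGrz⇒Models-grz {A = B} (Grzegorczyk.star⇒grz B star)) ⟨x⟩ m⟨x⟩)

allStar⇒starVariety : (V : Variety ℓ) → AllStar V → IsStarVariety V
allStar⇒starVariety V allStar =
  (λ _ → λ (mA , _) → mA) ,
  λ W models A mA → models A ((λ {s} {t} → mA {s} {t}) , allStar A mA)

allStar⇒full : (V : Variety ℓ) → AllStar V → Full (𝒪∣ V)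
allStar⇒full V allStar {A , mA} {B , _} k =
  extension (allStar A mA) , extension-extends (allStar A mA)
  where open Extension A B k

-- A homomorphism onto the subalgebra of open-generated elements that fixes the
-- open elements is injective, because z ≈ ⊤ as soon as the open element g z is.
full⇒allStar : (V : Variety ℓ) → Full (𝒪∣ V) → AllStar V
full⇒allStar V full A mA x = resp (≤-antisym rx≤x x≤rx) (proj₂ h.⟦ x ⟧)
  where
  open InteriorProperties A
  A* = subalgebra A IsOpen

  mA* : Models V A*
  mA* = Models-reflect {V = V} {A*} {A} {I = Fin 1}
    (λ _ → inclusion A IsOpen) (λ eq → eq Fin.zero) mA

  k : HeytingHom (A °) (A* °)
  k = record
    { ⟦_⟧    = λ (a , oa) → (a , base oa) , oa
    ; cong   = id
    ; ∨-homo = λ _ _ → refl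
    ; ∧-homo = λ _ _ → refl
    ; ⇨-homo = λ _ _ → refl
    ; ⊤-homo = refl
    ; ⊥-homo = refl
    }

  lifted = full {A , mA} {A* , mA*} k
  module h = InteriorHom (proj₁ lifted)

  r : InteriorHom A A
  r = Category._∘_ (IA _ _) {A} {A*} {A} (inclusion A IsOpen) (proj₁ lifted)
  module r = InteriorHom r

  r-open : ∀ {a} → IsOpen a → r.⟦ a ⟧ ≈ a
  r-open oa = proj₂ lifted (_ , oa)

  -- `r` fixes open elements, hence everything they generate, and the values of `r` are of that
  -- kind.
  r-idem : r.⟦ r.⟦ x ⟧ ⟧ ≈ r.⟦ x ⟧
  r-idem = hom-unique r (Category.id (IA _ _) {A}) r-open (proj₂ h.⟦ x ⟧)

  r-⊤ : ∀ {z} → r.⟦ z ⟧ ≈ ⊤ → ⊤ ≤ z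
  r-⊤ {z} p = ≤-trans (≤-reflexive (trans (sym g-⊤) (trans (g-cong (sym p))
    (trans (sym (r.g-homo z)) (r-open g-open))))) (g-≤ z)

  r-imp : ∀ {y z} → r.⟦ y ⟧ ≈ r.⟦ z ⟧ → y ≤ z
  r-imp {y} {z} p = entail 2 (λ y z → 𝟙 ⊑ ∼ y ⊔ z ⇛ ⊢ y ⊑ z) (_ ∷ _ ∷ [])
    (r-⊤ (trans (r.∨-homo _ _) (trans (∨-cong (r.¬-homo _) (sym p)) (∨-complementˡ _))))

  x≤rx : x ≤ r.⟦ x ⟧
  x≤rx = r-imp (sym r-idem)

  rx≤x : r.⟦ x ⟧ ≤ x
  rx≤x = r-imp r-idem

allStar⇒equivalent : (V : Variety ℓ) → AllStar V → CategoricallyEquivalent (𝐕 V) (γ-category V)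
allStar⇒equivalent {ℓ} V allStar =
  F , (λ {X} {Y} → full {X} {Y}) , (λ {X} {Y} → faithful {X} {Y}) , surjective
  where
  F : Functor (𝐕 V) (γ-category V)
  F = record
    { F₀ = λ (A , mA) → A ° , A , mA , record
        { to = Category.id (HA ℓ ℓ ℓ) {A °} ; from = Category.id (HA ℓ ℓ ℓ) {A °}
        ; to∘from = λ _ → InteriorAlgebra.refl A ; from∘to = λ _ → InteriorAlgebra.refl A }
    ; F₁ = λ {X} {Y} → O.F₁ {X} {Y}
    ; F-resp-≈     = λ {X} {Y} {h} {k} → O.F-resp-≈ {X} {Y} {h} {k}
    ; identity     = λ {X} → O.identity {X}
    ; homomorphism = λ {X} {Y} {Z} {h} {k} → O.homomorphism {X} {Y} {Z} {h} {k}
    }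
    where module O = Functor (𝒪∣ V)

  full : Full F
  full {X} {Y} k = allStar⇒full V allStar {X} {Y} k

  faithful : Faithful F
  faithful {A , mA} f f′ eq x =
    hom-unique f f′ (λ oa → eq (_ , oa)) (allStar A mA x)

  surjective : EssentiallySurjective F
  -- The isomorphism is repackaged because `Iso` in the full subcategory is a different type with
  -- the same fields.
  surjective (H , A , mA , iso) = (A , mA) , record { Iso iso }

-- Local finiteness

module _ (S : Setoid c ℓ) where
  open Setoid S

  lookup-injective : ∀ {xs} → Unique S xs → ∀ j k → lookup xs j ≈ lookup xs k → j ≡ k
  lookup-injective (_ ∷ _)  Fin.zero    Fin.zero    _ = ≡.refl
  lookup-injective (x∉ ∷ _) Fin.zero    (Fin.suc k) p =
    contradiction p (All.lookup x∉ (∈-lookup k))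
  lookup-injective (x∉ ∷ _) (Fin.suc j) Fin.zero    p =
    contradiction (sym p) (All.lookup x∉ (∈-lookup j))
  lookup-injective (_ ∷ u)  (Fin.suc j) (Fin.suc k) p =
    ≡.cong Fin.suc (lookup-injective u j k p)

enumerated⇒finite : (A : InteriorAlgebra c ℓ) → Decidable (InteriorAlgebra._≈_ A) →
                    ∀ {xs} → IsEnumeration (InteriorAlgebra.setoid A) xs → IsFinite A
enumerated⇒finite A _≟_ {xs} enum = length ys , record
  { to        = lookup ys
  ; from      = from
  ; to-cong   = λ { ≡.refl → refl }
  ; from-cong = λ {x} {y} x≈y → lookup-injective setoid unique (from x) (from y)
      (trans (lookup-from x) (trans x≈y (sym (lookup-from y))))
  ; inverse   = (λ {x} → λ { ≡.refl → lookup-from x })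
              , (λ {j} {x} x≈ → lookup-injective setoid unique (from x) j
                  (trans (lookup-from x) x≈))
  }
  where
  open InteriorAlgebra A
  decSetoid : DecSetoid _ _
  decSetoid = record { isDecEquivalence = record { isEquivalence = isEquivalence ; _≟_ = _≟_ } }

  ys     = deduplicate _≟_ xs
  unique = UniqueDec.deduplicate-! decSetoid xs
  enum′  = Enumerates.deduplicate⁺ decSetoid enum

  from : Carrier → Fin (length ys)
  from x = index (enum′ x)

  lookup-from : ∀ x → lookup ys (from x) ≈ x
  lookup-from x = sym (Any.lookup-index (enum′ x))

-- Indecomposable elements and minterms

module FiniteJoins (A : InteriorAlgebra c ℓ) where
  open InteriorProperties A

  ⋁ : List Carrier → Carrier
  ⋁ = foldr _∨_ ⊥

  Decides : Carrier → Carrier → Set ℓ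
  Decides α x = α ≤ x ⊎ α ≤ ¬ x

  -- Indecomposable elements are the atoms and ⊥.
  Indecomposable : Carrier → Set (c ⊔ˡ ℓ)
  Indecomposable α = ∀ x → Decides α x

  decides-antitone : ∀ {α β x} → α ≤ β → Decides β x → Decides α x
  decides-antitone α≤β (inj₁ p) = inj₁ (≤-trans α≤β p)
  decides-antitone α≤β (inj₂ p) = inj₂ (≤-trans α≤β p)

  decides-resp : ∀ {α x y} → x ≈ y → Decides α x → Decides α y
  decides-resp x≈y (inj₁ p) = inj₁ (≤-trans p (≤-reflexive x≈y))
  decides-resp x≈y (inj₂ p) = inj₂ (≤-trans p (≤-reflexive (¬-cong x≈y)))

  decides-¬ : ∀ {α x} → Decides α x → Decides α (¬ x)
  decides-¬ (inj₁ p) = inj₂ (entail 2 (λ α x → α ⊑ x ⇛ ⊢ α ⊑ ∼ (∼ x)) (_ ∷ _ ∷ []) p)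
  decides-¬ (inj₂ p) = inj₁ p

  decides-∨ : ∀ {α x y} → Decides α x → Decides α y → Decides α (x ∨ y)
  decides-∨ (inj₁ p) _        =
    inj₁ (entail 3 (λ α x y → α ⊑ x ⇛ ⊢ α ⊑ x ⊔ y) (_ ∷ _ ∷ _ ∷ []) p)
  decides-∨ (inj₂ _) (inj₁ q) =
    inj₁ (entail 3 (λ α x y → α ⊑ y ⇛ ⊢ α ⊑ x ⊔ y) (_ ∷ _ ∷ _ ∷ []) q)
  decides-∨ (inj₂ p) (inj₂ q) =
    inj₂ (entail 3 (λ α x y → α ⊑ ∼ x ⇛ α ⊑ ∼ y ⇛ ⊢ α ⊑ ∼ (x ⊔ y)) (_ ∷ _ ∷ _ ∷ []) p q)

  decides-∧ : ∀ {α x y} → Decides α x → Decides α y → Decides α (x ∧ y)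
  decides-∧ (inj₁ p) (inj₁ q) =
    inj₁ (entail 3 (λ α x y → α ⊑ x ⇛ α ⊑ y ⇛ ⊢ α ⊑ x ⊓ y) (_ ∷ _ ∷ _ ∷ []) p q)
  decides-∧ (inj₁ _) (inj₂ q) =
    inj₂ (entail 3 (λ α x y → α ⊑ ∼ y ⇛ ⊢ α ⊑ ∼ (x ⊓ y)) (_ ∷ _ ∷ _ ∷ []) q)
  decides-∧ (inj₂ p) _        =
    inj₂ (entail 3 (λ α x y → α ⊑ ∼ x ⇛ ⊢ α ⊑ ∼ (x ⊓ y)) (_ ∷ _ ∷ _ ∷ []) p)

  joins : List Carrier → List Carrier
  joins []       = ⊥ ∷ []
  joins (α ∷ αs) = map (α ∨_) (joins αs) ++ joins αs

  -- Each indecomposable element lies inside `x` or misses it, so `x ∧ ⋁ αs` is the join of those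
  -- inside.
  joins-cover : ∀ {αs} → All Indecomposable αs → ∀ x → Any (x ∧ ⋁ αs ≈_) (joins αs)
  joins-cover []         x = here (entail 1 (λ x → ⊢ x ⊓ 𝟘 ≐ 𝟘) (_ ∷ []))
  joins-cover (d ∷ ds) x with d x
  ... | inj₁ α≤x  = Any.++⁺ˡ (Any.map⁺ (Any.map
    (entail 4 (λ α x r y → α ⊑ x ⇛ x ⊓ r ≐ y ⇛ ⊢ x ⊓ (α ⊔ r) ≐ α ⊔ y) (_ ∷ _ ∷ _ ∷ _ ∷ []) α≤x)
    (joins-cover ds x)))
  ... | inj₂ α≤¬x = Any.++⁺ʳ _ (Any.map
    (entail 4 (λ α x r y → α ⊑ ∼ x ⇛ x ⊓ r ≐ y ⇛ ⊢ x ⊓ (α ⊔ r) ≐ y) (_ ∷ _ ∷ _ ∷ _ ∷ []) α≤¬x)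
    (joins-cover ds x))

  joins-enumerate : ∀ {αs} → All Indecomposable αs → ⊤ ≤ ⋁ αs → IsEnumeration setoid (joins αs)
  joins-enumerate ds ⊤≤⋁ x = Any.map
    (entail 3 (λ x o y → 𝟙 ⊑ o ⇛ x ⊓ o ≐ y ⇛ ⊢ x ≐ y) (_ ∷ _ ∷ _ ∷ []) ⊤≤⋁)
    (joins-cover ds x)

  cells : List Carrier → List Carrier
  cells []       = ⊤ ∷ []
  cells (x ∷ xs) = map (x ∧_) (cells xs) ++ map (¬ x ∧_) (cells xs)

  cells-decide : ∀ xs → All (λ d → All (Decides d) xs) (cells xs)
  cells-decide []       = [] ∷ []
  cells-decide (x ∷ xs) = All.++⁺
    (All.map⁺ (All.map (λ ds →
      inj₁ (entail 2 (λ x d → ⊢ x ⊓ d ⊑ x) (_ ∷ _ ∷ [])) ∷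
      All.map (decides-antitone (entail 2 (λ x d → ⊢ x ⊓ d ⊑ d) (_ ∷ _ ∷ []))) ds)
      (cells-decide xs)))
    (All.map⁺ (All.map (λ ds →
      inj₂ (entail 2 (λ x d → ⊢ ∼ x ⊓ d ⊑ ∼ x) (_ ∷ _ ∷ [])) ∷
      All.map (decides-antitone (entail 2 (λ x d → ⊢ ∼ x ⊓ d ⊑ d) (_ ∷ _ ∷ []))) ds)
      (cells-decide xs)))

  -- Iterates `grz-dense` over the minterms of `xs`: as `g (o ∨ (y ∧ d))` is
  -- `g (o ∨ y) ∧ g (o ∨ d)`, the induction continues on the smaller open element `e ∧ g (o ∨ y)`.
  cells-dense : Grzegorczyk.IsGrz A → ∀ {o} → IsOpen o → ∀ xs {e} → IsOpen e →
                All (λ d → e ∧ g (o ∨ d) ≤ o) (cells xs) → e ≤ o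
  cells-dense isGrz oo []       oe (p ∷ []) =
    entail 3 (λ e o t → t ≐ 𝟙 ⇛ e ⊓ t ⊑ o ⇛ ⊢ e ⊑ o) (_ ∷ _ ∷ _ ∷ [])
      (trans (g-cong (entail 1 (λ o → ⊢ o ⊔ 𝟙 ≐ 𝟙) (_ ∷ []))) g-⊤) p
  cells-dense isGrz {o} oo (x ∷ xs) {e} oe ps =
    Grzegorczyk.grz-dense A isGrz x oe oo
      (within x (All.map⁻ (All.++⁻ˡ (map (x ∧_) (cells xs)) ps)))
      (within (¬ x) (All.map⁻ (All.++⁻ʳ (map (x ∧_) (cells xs)) ps)))
    where
    within : ∀ y → All (λ d → e ∧ g (o ∨ (y ∧ d)) ≤ o) (cells xs) → e ∧ g (o ∨ y) ≤ o
    within y qs = cells-dense isGrz oo xs (∧-open oe g-open) (All.map (λ {d} →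
      entail 5 (λ e o u v w → w ≐ u ⊓ v ⇛ e ⊓ w ⊑ o ⇛ ⊢ (e ⊓ u) ⊓ v ⊑ o)
        (_ ∷ _ ∷ _ ∷ _ ∷ _ ∷ [])
        (trans (g-cong (∨-distribˡ-∧ o y d)) (g-∧ _ _))) qs)

-- Layers of a finitely generated algebra

module Layers (A : InteriorAlgebra c ℓ) (isGrz : Grzegorczyk.IsGrz A) {n}
              (a : Fin n → InteriorAlgebra.Carrier A)
              (generates : Generates A (λ x → ∃ λ i → InteriorAlgebra._≈_ A (a i) x)) where
  open InteriorProperties A
  open FiniteJoins A

  ◇_ : Carrier → Carrier
  ◇ x = ¬ g (¬ x)

  addCells : List Carrier → List Carrier → List Carrier
  addCells αs ds = map (λ d → g (⋁ αs ∨ d) ∧ ¬ ⋁ αs) ds ++ αs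

  colours : List Carrier → List Carrier
  colours αs = tabulate a ++ map ◇_ αs

  nextLayer : List Carrier → List Carrier
  nextLayer αs = addCells αs (cells (colours αs))

  addCells-≥ : ∀ αs ds → ⋁ αs ≤ ⋁ (addCells αs ds)
  addCells-≥ αs []       = ≤-refl
  addCells-≥ αs (d ∷ ds) = ≤-trans (addCells-≥ αs ds)
    (entail 2 (λ r s → ⊢ r ⊑ s ⊔ r) (_ ∷ _ ∷ []))

  -- The join already contains `⋁ αs`, so each added piece may be replaced by the open element
  -- `g (⋁ αs ∨ d)`.
  addCells-open : ∀ αs ds → IsOpen (⋁ αs) → IsOpen (⋁ (addCells αs ds))
  addCells-open αs []       oo = oo
  addCells-open αs (d ∷ ds) oo = IsOpen-resp
    (entail 3 (λ o u r → o ⊑ r ⇛ ⊢ u ⊔ r ≐ (u ⊓ ∼ o) ⊔ r) (_ ∷ _ ∷ _ ∷ []) (addCells-≥ αs ds))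
    (∨-open g-open (addCells-open αs ds oo))

  addCells-≤ : ∀ αs ds {e} → e ∧ ⋁ (addCells αs ds) ≤ ⋁ αs →
               All (λ d → e ∧ g (⋁ αs ∨ d) ≤ ⋁ αs) ds
  addCells-≤ αs []       p = []
  addCells-≤ αs (d ∷ ds) p =
    entail 4 (λ e u o r → e ⊓ ((u ⊓ ∼ o) ⊔ r) ⊑ o ⇛ ⊢ e ⊓ u ⊑ o) (_ ∷ _ ∷ _ ∷ _ ∷ []) p ∷
    addCells-≤ αs ds
      (entail 4 (λ e u o r → e ⊓ ((u ⊓ ∼ o) ⊔ r) ⊑ o ⇛ ⊢ e ⊓ r ⊑ o) (_ ∷ _ ∷ _ ∷ _ ∷ []) p)

  -- If `β` sees some `α` disjoint from `x`, it lies outside `g x`. Otherwise every `α` it sees lies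
  -- in `x`, and so, near `β`, does all of `⋁ αs`.
  decides-interior : ∀ {β x αs} → All Indecomposable αs → All (λ α → Decides β (◇ α)) αs →
                     β ≤ g (¬ ⋁ αs ∨ x) ⊎ β ≤ ¬ g x
  decides-interior {β} {x} [] [] = inj₁
    (entail 2 (λ β t → t ≐ 𝟙 ⇛ ⊢ β ⊑ t) (_ ∷ _ ∷ [])
      (trans (g-cong (entail 1 (λ x → ⊢ ∼ 𝟘 ⊔ x ≐ 𝟙) (_ ∷ []))) g-⊤))
  decides-interior {β} {x} {α ∷ αs} (i ∷ is) (d ∷ ds)
    with decides-interior {β} {x} is ds | i x | d
  ... | inj₂ q | _        | _        = inj₂ q
  ... | inj₁ q | inj₁ α≤x | _        = inj₁ (≤-trans q (g-mono
    (entail 3 (λ α x r → α ⊑ x ⇛ ⊢ ∼ r ⊔ x ⊑ ∼ (α ⊔ r) ⊔ x) (_ ∷ _ ∷ _ ∷ []) α≤x)))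
  ... | inj₁ q | inj₂ α≤¬x | inj₁ β≤◇α = inj₂
    (entail 3 (λ β gx b → gx ⊑ b ⇛ β ⊑ ∼ b ⇛ ⊢ β ⊑ ∼ gx) (_ ∷ _ ∷ _ ∷ [])
      (g-mono (entail 2 (λ α x → α ⊑ ∼ x ⇛ ⊢ x ⊑ ∼ α) (_ ∷ _ ∷ []) α≤¬x)) β≤◇α)
  ... | inj₁ q | inj₂ α≤¬x | inj₂ β≤¬◇α = inj₁
    (entail 4 (λ β b r s → β ⊑ r ⇛ β ⊑ ∼ (∼ b) ⇛ b ⊓ r ⊑ s ⇛ ⊢ β ⊑ s) (_ ∷ _ ∷ _ ∷ _ ∷ [])
      q β≤¬◇α (≤-trans (≤-reflexive (sym (g-∧ (¬ α) (¬ ⋁ αs ∨ x)))) (g-mono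
        (entail 3 (λ α x r → ⊢ ∼ α ⊓ (∼ r ⊔ x) ⊑ ∼ (α ⊔ r) ⊔ x) (α ∷ x ∷ ⋁ αs ∷ [])))))

  -- Induction on how the generators produce `x`; the colours settle the generators, and only
  -- interiors need the layer below.
  cell-indecomposable : ∀ {αs d} → All Indecomposable αs → All (Decides d) (colours αs) →
                        Indecomposable (g (⋁ αs ∨ d) ∧ ¬ ⋁ αs)
  cell-indecomposable {αs} {d} is ds x = go (generates x)
    where
    o β : Carrier
    o = ⋁ αs
    β = g (o ∨ d) ∧ ¬ o

    β≤d : β ≤ d
    β≤d = entail 3 (λ u o d → u ⊑ o ⊔ d ⇛ ⊢ u ⊓ ∼ o ⊑ d) (g (o ∨ d) ∷ o ∷ d ∷ []) (g-≤ _)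

    interior-decided : ∀ {x} → Decides β x → β ≤ g (¬ o ∨ x) ⊎ β ≤ ¬ g x → Decides β (g x)
    interior-decided {x} (inj₂ p) _        = inj₂
      (entail 3 (λ β x gx → gx ⊑ x ⇛ β ⊑ ∼ x ⇛ ⊢ β ⊑ ∼ gx) (β ∷ x ∷ g x ∷ []) (g-≤ x) p)
    interior-decided     (inj₁ _) (inj₂ q) = inj₂ q
    -- `g (o ∨ d) ∧ g (¬ o ∨ x)` is open, contains `β` and lies below `x`: outside `o` it is part of
    -- `β`, and inside `o` the second factor gives `x`.
    interior-decided {x} (inj₁ p) (inj₁ q) = inj₁
      (entail 4 (λ u o r gx → u ⊓ r ⊑ gx ⇛ u ⊓ ∼ o ⊑ r ⇛ ⊢ u ⊓ ∼ o ⊑ gx)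
        (g (o ∨ d) ∷ o ∷ g (¬ o ∨ x) ∷ g x ∷ [])
        (g-greatest (∧-open g-open g-open)
          (entail 4 (λ u o r x → r ⊑ ∼ o ⊔ x ⇛ u ⊓ ∼ o ⊑ x ⇛ ⊢ u ⊓ r ⊑ x)
            (g (o ∨ d) ∷ o ∷ g (¬ o ∨ x) ∷ x ∷ []) (g-≤ (¬ o ∨ x)) p))
        q)

    ◇-decided : All (λ α → Decides β (◇ α)) αs
    ◇-decided = All.map (decides-antitone β≤d) (All.map⁻ (All.++⁻ʳ (tabulate a) ds))

    go : ∀ {x} → Sg A (λ x → ∃ λ i → a i ≈ x) x → Decides β x
    go (base (i , ai≈x)) = decides-resp ai≈x
      (decides-antitone β≤d (All.tabulate⁻ (All.++⁻ˡ (tabulate a) ds) i))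
    go (resp x≈y s) = decides-resp x≈y (go s)
    go (∨-clos s t) = decides-∨ (go s) (go t)
    go (∧-clos s t) = decides-∧ (go s) (go t)
    go (¬-clos s)   = decides-¬ (go s)
    go (g-clos s)   = interior-decided (go s) (decides-interior is ◇-decided)
    go ⊤-clos       = inj₁ (entail 1 (λ β → ⊢ β ⊑ 𝟙) (β ∷ []))
    go ⊥-clos       = inj₂ (entail 1 (λ β → ⊢ β ⊑ ∼ 𝟘) (β ∷ []))

  layers : ℕ → List Carrier
  layers zero    = []
  layers (suc n) = nextLayer (layers n)

  layers-indecomposable : ∀ n → All Indecomposable (layers n)
  layers-indecomposable zero    = []
  layers-indecomposable (suc n) = All.++⁺
    (All.map⁺ (All.map (cell-indecomposable (layers-indecomposable n))
      (cells-decide (colours (layers n)))))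
    (layers-indecomposable n)

  layers-open : ∀ n → IsOpen (⋁ (layers n))
  layers-open zero    = ⊥-open
  layers-open (suc n) = addCells-open (layers n) (cells (colours (layers n))) (layers-open n)

  layers-step : ∀ n → ⋁ (layers n) ≤ ⋁ (layers (suc n))
  layers-step n = addCells-≥ (layers n) (cells (colours (layers n)))

  layers-dense : ∀ n {e} → IsOpen e → e ∧ ⋁ (layers (suc n)) ≤ ⋁ (layers n) → e ≤ ⋁ (layers n)
  layers-dense n oe p = cells-dense isGrz (layers-open n) (colours (layers n)) oe
    (addCells-≤ (layers n) (cells (colours (layers n))) p)

-- Alternating elements and the length of normal forms

module Alternation (A : InteriorAlgebra c ℓ)
  (o : ℕ → InteriorAlgebra.Carrier A)
  (step : ∀ n → InteriorAlgebra._≤_ A (o n) (o (suc n)))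
  (dense : ∀ n {e} → InteriorAlgebra.IsOpen A e →
           InteriorAlgebra._≤_ A (InteriorAlgebra._∧_ A e (o (suc n))) (o n) →
           InteriorAlgebra._≤_ A e (o n)) where
  open InteriorProperties A

  double : ℕ → ℕ
  double zero    = zero
  double (suc n) = suc (suc (double n))

  even odd : ℕ → Carrier
  even j = o (double j)
  odd  j = o (suc (double j))

  even-mono : ∀ {i j} → i ℕ.≤ j → even i ≤ even j
  even-mono = sequence-mono A even (λ _ → ≤-trans (step _) (step _))

  odd-mono : ∀ {i j} → i ℕ.≤ j → odd i ≤ odd j
  odd-mono = sequence-mono A odd (λ _ → ≤-trans (step _) (step _))

  alternating : ℕ → Carrier
  alternating zero    = ⊥
  alternating (suc n) = alternating n ∨ (even (suc n) ∧ ¬ odd n)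

  -- The piece with index `i` lies below `even j` if `i < j`, and misses `odd j` otherwise.
  alternating-below : ∀ n j → alternating n ∧ odd j ≤ even j
  alternating-below zero    j = entail 2 (λ x y → ⊢ 𝟘 ⊓ x ⊑ y) (_ ∷ _ ∷ [])
  alternating-below (suc n) j with n ℕ.<? j
  ... | yes n<j = entail 5 (λ x y z u v → x ⊓ u ⊑ v ⇛ y ⊑ v ⇛ ⊢ (x ⊔ (y ⊓ ∼ z)) ⊓ u ⊑ v)
    (_ ∷ _ ∷ _ ∷ _ ∷ _ ∷ []) (alternating-below n j) (even-mono n<j)
  ... | no  n≮j = entail 5 (λ x y z u v → x ⊓ u ⊑ v ⇛ u ⊑ z ⇛ ⊢ (x ⊔ (y ⊓ ∼ z)) ⊓ u ⊑ v)
    (_ ∷ _ ∷ _ ∷ _ ∷ _ ∷ []) (alternating-below n j) (odd-mono (ℕ.≮⇒≥ n≮j))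

  alternating-above : ∀ {n j} → j ℕ.<′ n → even (suc j) ≤ odd j ∨ alternating n
  alternating-above ℕ.<′-base       =
    entail 3 (λ x y z → ⊢ y ⊑ z ⊔ (x ⊔ (y ⊓ ∼ z))) (_ ∷ _ ∷ _ ∷ [])
  alternating-above (ℕ.<′-step j<n) = ≤-trans (alternating-above j<n)
    (entail 3 (λ x y z → ⊢ z ⊔ x ⊑ z ⊔ (x ⊔ y)) (_ ∷ _ ∷ _ ∷ []))

  -- `2 ^ m - 1` in closed form: each clause costs two inductive calls and one extra step.
  rank : ℕ → ℕ
  rank zero    = zero
  rank (suc n) = suc (rank n + rank n)

  -- `C` will be the power of `A` and `k` a projection, so one list of clauses is read in each
  -- coordinate.
  module _ (C : InteriorAlgebra c₁ ℓ₁) (k : HeytingHom (C °) (A °)) where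
    open Clauses C using (Clause)
    open Value C A k

    -- For the first clause ¬ a ∨ b, the remaining clauses L bound e ∧ b and hence e ∧ a;
    -- beyond that bound the clause is vacuous on e, so L bounds e as well.
    alternation-bound : ∀ N (L : List Clause) s {e} → IsOpen e → s + rank (length L) ℕ.≤ N →
      (e ∧ ¬ even s) ∧ alternating N ≤ value L →
      (e ∧ ¬ even s) ∧ value L ≤ alternating N →
      e ≤ even (s + rank (length L))
    -- With no clauses, `e` outside `even s` is contained in `alternating N`, which misses the band
    -- from `even s` to `odd s`; density finishes.
    alternation-bound N [] s {e} oe _ _ q = ≤-trans
      (dense _ oe (entail 4 (λ e p x u → (e ⊓ ∼ p) ⊓ 𝟙 ⊑ x ⇛ x ⊓ u ⊑ p ⇛ ⊢ e ⊓ u ⊑ p)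
        (_ ∷ _ ∷ _ ∷ _ ∷ []) q (alternating-below N s)))
      (even-mono (ℕ.m≤m+n s 0))
    alternation-bound N ((a , b) ∷ L) s {e} oe s+≤N p q =
      ≡.subst (λ j → e ≤ even j) s′+r≡ e≤
      where
      r s′ : ℕ
      r  = rank (length L)
      s′ = suc (s + r)

      s′+r≡ : s′ + r ≡ s + suc (r + r)
      s′+r≡ = ≡.trans (≡.cong suc (ℕ.+-assoc s r r)) (≡.sym (ℕ.+-suc s (r + r)))

      s′+r≤N : s′ + r ℕ.≤ N
      s′+r≤N = ≡.subst (ℕ._≤ N) (≡.sym s′+r≡) s+≤N

      s′≤N : s′ ℕ.≤ N
      s′≤N = ℕ.≤-trans (ℕ.m≤m+n s′ r) s′+r≤N

      e∧b≤ : e ∧ ⟪ b ⟫ ≤ even (s + r)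
      e∧b≤ = alternation-bound N L s (∧-open oe (proj₂ (HeytingHom.⟦ k ⟧ b)))
        (ℕ.≤-trans (ℕ.n≤1+n _) s′≤N)
        (entail 6 (λ e p x a b v → (e ⊓ ∼ p) ⊓ x ⊑ (∼ a ⊔ b) ⊓ v ⇛
            ⊢ ((e ⊓ b) ⊓ ∼ p) ⊓ x ⊑ v) (_ ∷ _ ∷ _ ∷ _ ∷ _ ∷ _ ∷ []) p)
        (entail 6 (λ e p x a b v → (e ⊓ ∼ p) ⊓ ((∼ a ⊔ b) ⊓ v) ⊑ x ⇛
            ⊢ ((e ⊓ b) ⊓ ∼ p) ⊓ v ⊑ x) (_ ∷ _ ∷ _ ∷ _ ∷ _ ∷ _ ∷ []) q)

      e∧a∧x≤ : (e ∧ ⟪ a ⟫) ∧ alternating N ≤ even (s + r)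
      e∧a∧x≤ = entail 7 (λ e p x a b v p′ → (e ⊓ ∼ p) ⊓ x ⊑ (∼ a ⊔ b) ⊓ v ⇛ p ⊑ p′ ⇛ e ⊓ b ⊑ p′ ⇛
          ⊢ (e ⊓ a) ⊓ x ⊑ p′) (_ ∷ _ ∷ _ ∷ _ ∷ _ ∷ _ ∷ _ ∷ [])
        p (even-mono (ℕ.m≤m+n s r)) e∧b≤

      -- As `s + r < N`, the band from `odd (s + r)` to `even s′` lies in `alternating N`, which
      -- meets `e ∧ ⟪ a ⟫` only below `even (s + r)`. So `e ∧ ⟪ a ⟫` has nothing in that band.
      e∧a≤ : e ∧ ⟪ a ⟫ ≤ even s′
      e∧a≤ = ≤-trans
        (dense _ (∧-open oe (proj₂ (HeytingHom.⟦ k ⟧ a)))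
          (entail 5 (λ f x p q p′ → f ⊓ x ⊑ p ⇛ p ⊑ q ⇛ p′ ⊑ q ⊔ x ⇛ ⊢ f ⊓ p′ ⊑ q)
            (_ ∷ _ ∷ _ ∷ _ ∷ _ ∷ [])
            e∧a∧x≤ (step _) (alternating-above (ℕ.≤⇒≤′ s′≤N))))
        (step _)

      even-s≤ : even s ≤ even s′
      even-s≤ = even-mono (ℕ.≤-trans (ℕ.m≤m+n s r) (ℕ.n≤1+n _))

      e≤ : e ≤ even (s′ + r)
      e≤ = alternation-bound N L s′ oe s′+r≤N
        (entail 7 (λ e p x a b v p′ → p ⊑ p′ ⇛ (e ⊓ ∼ p) ⊓ x ⊑ (∼ a ⊔ b) ⊓ v ⇛
            ⊢ (e ⊓ ∼ p′) ⊓ x ⊑ v) (_ ∷ _ ∷ _ ∷ _ ∷ _ ∷ _ ∷ _ ∷ []) even-s≤ p)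
        (entail 7 (λ e p x a b v p′ → p ⊑ p′ ⇛ e ⊓ a ⊑ p′ ⇛ (e ⊓ ∼ p) ⊓ ((∼ a ⊔ b) ⊓ v) ⊑ x ⇛
            ⊢ (e ⊓ ∼ p′) ⊓ v ⊑ x) (_ ∷ _ ∷ _ ∷ _ ∷ _ ∷ _ ∷ _ ∷ []) even-s≤ e∧a≤ q)

value-homo : {A B : InteriorAlgebra c ℓ} (h : InteriorHom A B) (L : List (Clauses.Clause A)) →
  InteriorAlgebra._≈_ B (InteriorHom.⟦ h ⟧ (NormalForm.value A L))
                        (Value.value A B (Functor.F₁ 𝒪 h) L)
value-homo h [] = InteriorHom.⊤-homo h
value-homo {B = B} h (_ ∷ L) =
  trans (∧-homo _ _) (∧-cong (trans (∨-homo _ _) (∨-cong (¬-homo _) refl)) (value-homo h L))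
  where
  open InteriorAlgebra B
  open InteriorHom h

allStar⇒locallyFinite : (∀ a → ExcludedMiddle a) → (V : Variety ℓ) → AllStar V → IsLocallyFinite V
allStar⇒locallyFinite em V allStar A mA (n , a , generates) =
  enumerated⇒finite A (λ _ _ → em _)
    (joins-enumerate (layers-indecomposable (double N)) ⊤≤)
  where
  open InteriorProperties A
  open FiniteJoins A
  open Layers A (Grzegorczyk.star⇒grz A (allStar A mA)) a generates
  open Alternation A (λ n → ⋁ (layers n)) layers-step layers-dense

  Aᴺ : InteriorAlgebra _ _
  Aᴺ = power A ℕ

  mAᴺ : Models V Aᴺ
  mAᴺ = Models-reflect {V = V} {Aᴺ} {A} (projection A) id mA

  nf = NormalForm.normalForm Aᴺ (allStar Aᴺ mAᴺ alternating)
  L  = proj₁ nf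
  -- The clauses are found in the power before any coordinate is fixed, so the coordinate may depend
  -- on their number.
  N  = rank (length L)

  π : InteriorHom Aᴺ A
  π = projection A N

  value≈ : Value.value Aᴺ A (Functor.F₁ 𝒪 π) L ≈ alternating N
  value≈ = trans (sym (value-homo π L)) (proj₂ nf N)

  ⊤≤ : ⊤ ≤ ⋁ (layers (double N))
  ⊤≤ = alternation-bound Aᴺ (Functor.F₁ 𝒪 π) N L 0 g-⊤ ℕ.≤-refl
    (entail 3 (λ x v w → v ≐ x ⇛ ⊢ w ⊓ x ⊑ v) (_ ∷ _ ∷ _ ∷ []) value≈)
    (entail 3 (λ x v w → v ≐ x ⇛ ⊢ w ⊓ v ⊑ x) (_ ∷ _ ∷ _ ∷ []) value≈)

theorem5p11 : (∀ a → ExcludedMiddle a) → ∀ {ℓ : Level} (V : Variety ℓ) →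
    (Full (𝒪∣ V) ⇔ (IsLocallyFinite V × IsStarVariety V)) ×
    (Full (𝒪∣ V) → CategoricallyEquivalent (𝐕 V) (γ-category V))
theorem5p11 em V =
  mk⇔ {A = Full (𝒪∣ V)} to (λ (locallyFinite , star) {X} {Y} →
    allStar⇒full V (locallyFinite-star⇒allStar V locallyFinite star) {X} {Y}) ,
  λ full → allStar⇒equivalent V (full⇒allStar V (λ {X} {Y} → full {X} {Y}))
  where
  to : Full (𝒪∣ V) → IsLocallyFinite V × IsStarVariety V
  to full = allStar⇒locallyFinite em V allStar , allStar⇒starVariety V allStar
    where allStar = full⇒allStar V (λ {X} {Y} → full {X} {Y})
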